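{- Let $G$ be a graph of order $n$ with maximum degree $\Delta(G)=2$. Then $\mathcal{A}(G)\ge \mathcal{A}\big(K_{\chi(G)}\cup(n-\chi(G))K_1\big)$, with equality if and only if $G\simeq K_{\chi(G)}\cup (n-\chi(G))K_1$.
   Context: All graphs are finite, simple and undirected. A coloring of a graph $G$ assigns colors to its vertices so that adjacent vertices receive different colors; two colorings are equivalent if they induce the same partition of the vertex set into color classes. $S(G,k)$ denotes the number of non-equivalent colorings of $G$ using exactly $k$ colors. Set $\mathcal{B}(G)=\sum_{k\ge1}S(G,k)$, $\mathcal{T}(G)=\sum_{k\ge1}kS(G,k)$ and $\mathcal{A}(G)=\mathcal{T}(G)/\mathcal{B}(G)$. $\chi(G)$ is the chromatic number, $K_r$ the complete graph on $r$ vertices, $\cup$ disjoint union, and $pK_1$ denotes $p$ isolated vertices. -}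

module Defs where

open import Data.Nat using (ℕ; zero; suc; _+_; _*_; _∸_; _⊔_; _<_; _<ᵇ_; _≡ᵇ_)
open import Data.Fin using (Fin; toℕ)
open import Data.Fin.Properties using (_≟_)
open import Data.Bool using (Bool; true; false; _∧_; not; if_then_else_)
open import Data.List using (List; []; _∷_; map; concatMap; filter; length; foldr; allFin)
open import Data.Bool.ListAction using (all; any)
open import Data.Vec using (Vec; []; _∷_; lookup)
open import Data.Integer using (+_)
open import Data.Rational using (ℚ; _/_)
open import Data.Product using (Σ; _×_)
open import Relation.Nullary using (¬_; does)
open import Relation.Binary.PropositionalEquality using (_≡_; _≢_)
open import Function.Bundles using (_↔_; Inverse)

record Graph (n : ℕ) : Set where
  field
    adj    : Fin n → Fin n → Bool
    sym    : ∀ i j → adj i j ≡ adj j i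
    irrefl : ∀ i → adj i i ≡ false
open Graph public

deg : ∀ {n} → Graph n → Fin n → ℕ
deg {n} G v = length (filter (λ w → adj G v w Data.Bool.≟ true) (allFin n))

maxDegree : ∀ {n} → Graph n → ℕ
maxDegree {n} G = foldr _⊔_ 0 (map (deg G) (allFin n))

Proper : ∀ {n k} → Graph n → (Fin n → Fin k) → Set
Proper G c = ∀ i j → adj G i j ≡ true → c i ≢ c j

IsChromaticNumber : ∀ {n} → Graph n → ℕ → Set
IsChromaticNumber {n} G k =
  Σ (Fin n → Fin k) (Proper G) ×
  (∀ m → m < k → ¬ Σ (Fin n → Fin m) (Proper G))

_≅_ : ∀ {n m} → Graph n → Graph m → Set
_≅_ {n} {m} G H = Σ (Fin n ↔ Fin m) λ f →
  ∀ i j → adj H (Inverse.to f i) (Inverse.to f j) ≡ adj G i j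

module KrUnionPK1-Construction (r p : ℕ) where
  open import Relation.Binary.PropositionalEquality using (refl; cong)
  a : Fin (r + p) → Fin (r + p) → Bool
  a i j = (toℕ i <ᵇ r) ∧ (toℕ j <ᵇ r) ∧ not (toℕ i ≡ᵇ toℕ j)
  ≡ᵇ-refl : ∀ x → (x ≡ᵇ x) ≡ true
  ≡ᵇ-refl zero = refl
  ≡ᵇ-refl (suc x) = ≡ᵇ-refl x
  ≡ᵇ-sym : ∀ x y → (x ≡ᵇ y) ≡ (y ≡ᵇ x)
  ≡ᵇ-sym zero zero = refl
  ≡ᵇ-sym zero (suc y) = refl
  ≡ᵇ-sym (suc x) zero = refl
  ≡ᵇ-sym (suc x) (suc y) = ≡ᵇ-sym x y
  symP : ∀ i j → a i j ≡ a j i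
  symP i j with toℕ i <ᵇ r | toℕ j <ᵇ r
  ... | false | false = refl
  ... | false | true  = refl
  ... | true  | false = refl
  ... | true  | true  = cong not (≡ᵇ-sym (toℕ i) (toℕ j))
  irr : ∀ i → a i i ≡ false
  irr i with toℕ i <ᵇ r
  ... | false = refl
  ... | true rewrite ≡ᵇ-refl (toℕ i) = refl

KrUnionPK1 : (r p : ℕ) → Graph (r + p)
KrUnionPK1 r p = record { adj = a ; sym = symP ; irrefl = irr }
  where open KrUnionPK1-Construction r p

-- Counting non-equivalent colorings with exactly k colors.
-- Each partition of the vertex set into k nonempty independent sets
-- corresponds to exactly one surjective proper coloring c : Fin n → Fin k
-- in canonical ("restricted growth") form: the first vertex of color m+1
-- comes after the first vertex of color m.

allVecs : (n k : ℕ) → List (Vec (Fin k) n)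
allVecs zero    k = [] ∷ []
allVecs (suc n) k = concatMap (λ v → map (λ x → x ∷ v) (allFin k)) (allVecs n k)

properᵇ : ∀ {n k} → Graph n → Vec (Fin k) n → Bool
properᵇ {n} G c = all (λ i → all (λ j →
  if adj G i j then not (does (lookup c i ≟ lookup c j)) else true) (allFin n)) (allFin n)

surjᵇ : ∀ {n k} → Vec (Fin k) n → Bool
surjᵇ {n} {k} c = all (λ x → any (λ i → does (lookup c i ≟ x)) (allFin n)) (allFin k)

canonicalᵇ : ∀ {n k} → Vec (Fin k) n → Bool
canonicalᵇ {n} c = all (λ i → (toℕ (lookup c i) ≡ᵇ 0) Data.Bool.∨
  any (λ j → (toℕ j <ᵇ toℕ i) ∧ (suc (toℕ (lookup c j)) ≡ᵇ toℕ (lookup c i))) (allFin n))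
  (allFin n)

S : ∀ {n} → Graph n → ℕ → ℕ
S {n} G k = length (filter (λ c → (properᵇ G c ∧ surjᵇ c ∧ canonicalᵇ c) Data.Bool.≟ true)
                           (allVecs n k))

-- sums over k = 1 .. n (S(G,k) = 0 for k > n)
sumTo : ℕ → (ℕ → ℕ) → ℕ
sumTo zero    f = 0
sumTo (suc m) f = sumTo m f + f (suc m)

𝓑 : ∀ {n} → Graph n → ℕ
𝓑 {n} G = sumTo n (S G)

𝓣 : ∀ {n} → Graph n → ℕ
𝓣 {n} G = sumTo n (λ k → k * S G k)

-- t / b as a rational (b = 0 never occurs for n ≥ 1; we set t/0 := 0)
ratio : ℕ → ℕ → ℚ
ratio t zero    = + 0 / 1
ratio t (suc b) = + t / suc b

𝓐 : ∀ {n} → Graph n → ℚ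
𝓐 G = ratio (𝓣 G) (𝓑 G)

{-# OPTIONS --safe #-}
module Submission where

-- Let P_G(q) = Σ_k S(G,k) q(q-1)…(q-k+1) be the number of proper colourings with q colours.
-- If q is Poisson of mean 1, every falling factorial has mean 1, so B(G) = E[P_G(q)] and
-- B(G) + T(G) = E[q P_G(q)].  By Chebyshev's correlation inequality A(G) ≥ A(H) therefore holds
-- as soon as P_G / P_H is nondecreasing on the natural numbers, strictly if it increases somewhere.
-- A graph of maximum degree 2 is a union of paths and cycles, and each factor
-- of its P_G is explicit: q, q - 1, (q-1)((q-1)^{m-1} + 1) for m even, and
-- q(q-1)(q-2)(1 + (q-1)² + … + (q-1)^{m-3}) for m odd.  These have nondecreasing ratios to
-- powers of q even after K₂ (if χ = 2) or K₃ (if χ = 3) has been split off from one of them.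
-- The Poisson means are replaced by sums truncated at N and scaled by N!: the truncation error
-- is polynomial in N, while the gain from a strict increase is of the order of (N!)².

open import Defs hiding (sym)
open import Data.Bool using (Bool; true; false; T; _∧_; _∨_; not; if_then_else_)
import Data.Bool as Bool
open import Data.Bool.ListAction using (all; any)
open import Data.Bool.Properties using (¬-not; not-¬)
open import Data.Empty using (⊥-elim)
open import Data.Fin using (Fin; zero; suc; toℕ; fromℕ<; punchIn; punchOut)
open import Data.Fin.Permutation using (Permutation; _⟨$⟩ʳ_; _⟨$⟩ˡ_; _∘ₚ_; inverseˡ; inverseʳ; punchIn-permute; remove; transpose)
open import Data.Fin.Properties using (_≟_; any?; punchIn-injective; punchIn-punchOut; punchInᵢ≢i; toℕ-fromℕ<; toℕ-injective; toℕ<n)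
import Data.Integer as ℤ
import Data.Integer.Properties as ℤ
open import Data.List using (List; []; _∷_; _++_; allFin; concatMap; filter; foldr; length)
import Data.List as List
open import Data.List.Membership.Propositional using (_∈_)
open import Data.List.Membership.Propositional.Properties using (∈-allFin; ∈-filter⁺; ∈-filter⁻)
open import Data.List.Relation.Unary.All using (_∷_)
open import Data.List.Relation.Unary.AllPairs using (_∷_)
open import Data.List.Relation.Unary.Any using (here; there)
open import Data.List.Relation.Unary.Unique.Propositional using (Unique)
open import Data.List.Relation.Unary.Unique.Propositional.Properties using (allFin⁺; filter⁺)
open import Data.Nat hiding (_≟_)
import Data.Nat as ℕ
open import Data.Nat.Properties hiding (_≟_)
open import Algebra.Properties.Semiring.Sum +-*-semiring using (sum; sum-cong-≗; sum-permute; sum-replicate-zero; ∑-comm; ∑-distrib-+; *-distribˡ-sum)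
open import Data.Nat.Tactic.RingSolver using (solve-∀)
open import Data.Product using (Σ; ∃; ∃₂; _×_; _,_; proj₁; proj₂)
import Data.Rational as ℚ
import Data.Rational.Properties as ℚ
open import Data.Rational.Unnormalised using (mkℚᵘ; *≤*; *<*)
import Data.Rational.Unnormalised.Properties as ℚᵘ
open import Data.Sum using (_⊎_; inj₁; inj₂; [_,_]′)
open import Data.Vec using (Vec; []; _∷_; insertAt; lookup; map; tabulate)
open import Data.Vec.Properties using (insertAt-lookup; insertAt-punchIn; lookup-map; lookup∘tabulate; map-cong; map-∘; tabulate-cong)
open import Function using (_∘_; _⇔_; id; mk⇔)
open import Relation.Binary.Definitions using (tri<; tri≈; tri>)
open import Relation.Binary.PropositionalEquality using (_≡_; _≢_; _≗_; cong; cong₂; refl; subst; subst₂; sym; trans)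
open import Relation.Nullary using (Dec; does; no; yes; ¬_)
open import Relation.Nullary.Decidable using (_×-dec_; dec-false; dec-true; toWitness; ¬?)

-- Poisson averages

-- Multiplying by q turns the weight S(G,k) into (k+1) S(G,k) on average, so Chebyshev's inequality
-- reads B(G) (B(H) + T(H)) ≤ (B(G) + T(G)) B(H), and the common term B(G) B(H) cancels. Ratios are
-- always cross-multiplied, because both polynomials vanish at small q. Since products of
-- nondecreasing ratios are nondecreasing, only one component has to pay for the K₂ or K₃ that is
-- split off; all others are compared with powers of q. The limit is avoided by integrality: a false
-- inequality between the integer means fails by at least 1, hence by the square of the normaliser
-- after scaling, whereas truncation costs only the normaliser times a polynomial. Equality: for χ =
-- 2 a vertex of degree two always forces a strict increase, as K₂ ∪ pK₁ has no such vertex; for χ =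
-- 3 the increase is missing only when a single triangle carries all the edges. Values at 3 are
-- positive, so χ ≤ 3 and the step from 3 to 4 is a uniform place to look for strictness.

fall : ℕ → ℕ → ℕ
fall q zero    = 1
fall q (suc k) = q * fall (q ∸ 1) k

-- Behind the formula for E[q P_G(q)]: when all falling factorials have mean 1, the right side has
-- mean `1 + k`.
*-fall : ∀ q k → q * fall q k ≡ fall q (suc k) + k * fall q k
*-fall q zero = sym (+-identityʳ _)
*-fall zero (suc k) = sym (*-zeroʳ k)
*-fall (suc q) (suc k) =
  trans (cong (λ z → suc q * (fall q k + z)) (*-fall q k)) (lemma q k (fall q k) (fall q (suc k)))
  where
  lemma : ∀ q k x y → suc q * (x + (y + k * x)) ≡ suc q * y + suc k * (suc q * x)
  lemma = solve-∀

-- Since `a < b` is `suc a ≤ b`, strict goals pass through here as well, with `cong suc` in front of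
-- the first equation.
≤-congˡʳ : ∀ {a b c d} → a ≡ c → c ≤ d → b ≡ d → a ≤ b
≤-congˡʳ refl le refl = le

-- X N f = Σ_{j ≤ N} (N! / j!) f j : up to the factor e·N!, the expectation of f under the
-- Poisson distribution of mean 1, truncated at N.
X : ℕ → (ℕ → ℕ) → ℕ
X zero    f = f 0
X (suc N) f = suc N * X N f + f (suc N)

E : ℕ → ℕ
E N = X N (λ _ → 1)

X-cong : ∀ {f g} → f ≗ g → ∀ N → X N f ≡ X N g
X-cong e zero    = e 0
X-cong e (suc N) = cong₂ (λ a b → suc N * a + b) (X-cong e N) (e (suc N))

X-+ : ∀ f g N → X N (λ j → f j + g j) ≡ X N f + X N g
X-+ f g zero    = refl
X-+ f g (suc N) = trans (cong (λ z → suc N * z + (f (suc N) + g (suc N))) (X-+ f g N)) (lemma (suc N) (X N f) (X N g) (f (suc N)) (g (suc N)))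
  where
  lemma : ∀ n a b c d → n * (a + b) + (c + d) ≡ (n * a + c) + (n * b + d)
  lemma = solve-∀

X-* : ∀ c f N → X N (λ j → c * f j) ≡ c * X N f
X-* c f zero    = refl
X-* c f (suc N) = trans (cong (λ z → suc N * z + c * f (suc N)) (X-* c f N)) (lemma (suc N) c (X N f) (f (suc N)))
  where
  lemma : ∀ n c a b → n * (c * a) + c * b ≡ c * (n * a + b)
  lemma = solve-∀

-- Stein's identity for the Poisson law, exact under truncation:
-- `j · (N+1)!/j! = (N+1) · N!/(j-1)!`, and the term `j = 0` vanishes. The truncation point drops by
-- one.
X-shift : ∀ g N → X (suc N) (λ j → j * g (j ∸ 1)) ≡ suc N * X N g
X-shift g zero    = refl
X-shift g (suc N) = trans (cong (λ z → suc (suc N) * z + suc (suc N) * g (suc N)) (X-shift g N))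
                          (lemma (suc (suc N)) (suc N * X N g) (g (suc N)))
  where
  lemma : ∀ n a b → n * a + n * b ≡ n * (a + b)
  lemma = solve-∀

X-fall-≤ : ∀ k N → X N (λ q → fall q k) ≤ E N
X-fall-≤ zero    N       = ≤-refl
X-fall-≤ (suc k) zero    = z≤n
X-fall-≤ (suc k) (suc N) = ≤-trans (≤-reflexive (X-shift (λ q → fall q k) N))
  (≤-trans (*-monoʳ-≤ (suc N) (X-fall-≤ k N)) (m≤m+n _ 1))

-- After `k` shifts, `X N (λ q → fall q k)` is the sum of `N!/i!` over `i ≤ N - k`. At most `k`
-- terms of `E N` are missing, each at most `(N+1)^k`.
E≤X-fall : ∀ k N → E N ≤ X N (λ q → fall q k) + k * suc N ^ k
E≤X-fall zero    N       = m≤m+n _ _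
E≤X-fall (suc k) zero    = ≤-trans (m^n>0 1 (suc k)) (m≤m+n _ _)
E≤X-fall (suc k) (suc N) = begin
  suc N * E N + 1                             ≤⟨ +-monoˡ-≤ 1 (*-monoʳ-≤ (suc N) (E≤X-fall k N)) ⟩
  suc N * (x + k * suc N ^ k) + 1             ≡⟨ lemma (suc N) x k (suc N ^ k) ⟩
  suc N * x + (k * (suc N * suc N ^ k) + 1)   ≤⟨ +-monoʳ-≤ (suc N * x) (+-mono-≤ (*-monoʳ-≤ k pow) (m^n>0 (2 + N) (suc k))) ⟩
  suc N * x + (k * p + p)                     ≡⟨ cong₂ _+_ (sym (X-shift (λ q → fall q k) N)) (+-comm (k * p) p) ⟩
  X (suc N) (λ q → fall q (suc k)) + suc k * p ∎
  where
  open ≤-Reasoning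
  x = X N (λ q → fall q k)
  p = suc (suc N) ^ suc k
  pow : suc N ^ suc k ≤ p
  pow = ^-monoˡ-≤ (suc k) (n≤1+n (suc N))
  lemma : ∀ n x k p → n * (x + k * p) + 1 ≡ n * x + (k * (n * p) + 1)
  lemma = solve-∀

^-distribʳ-* : ∀ n a b → (a * b) ^ n ≡ a ^ n * b ^ n
^-distribʳ-* zero    a b = refl
^-distribʳ-* (suc n) a b = trans (cong (a * b *_) (^-distribʳ-* n a b)) (lemma a b (a ^ n) (b ^ n))
  where
  lemma : ∀ a b x y → a * b * (x * y) ≡ a * x * (b * y)
  lemma = solve-∀

PolyBounded : (ℕ → ℕ) → Set
PolyBounded f = ∃₂ λ C d → ∀ N → f N ≤ C * suc N ^ d

poly-+ : ∀ {f g} → PolyBounded f → PolyBounded g → PolyBounded (λ N → f N + g N)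
poly-+ (C , d , p) (D , e , q) = C + D , d + e , λ N →
  ≤-trans (+-mono-≤ (≤-trans (p N) (*-monoʳ-≤ C (^-monoʳ-≤ (suc N) (m≤m+n d e))))
                    (≤-trans (q N) (*-monoʳ-≤ D (^-monoʳ-≤ (suc N) (m≤n+m e d)))))
          (≤-reflexive (sym (*-distribʳ-+ (suc N ^ (d + e)) C D)))

poly-* : ∀ c {f} → PolyBounded f → PolyBounded (λ N → c * f N)
poly-* c (C , d , p) = c * C , d , λ N → ≤-trans (*-monoʳ-≤ c (p N)) (≤-reflexive (sym (*-assoc c C _)))

-- Convergence of `X N f / E N` to `b`, without division or limits. The upper bound carries no error
-- because truncating a nonnegative combination of falling factorials only loses mass.
record HasMean (f : ℕ → ℕ) (b : ℕ) : Set where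
  constructor hasMean
  field
    err   : ℕ → ℕ
    poly  : PolyBounded err
    upper : ∀ N → X N f ≤ b * E N
    lower : ∀ N → b * E N ≤ X N f + err N

mean-cong : ∀ {f g b} → f ≗ g → HasMean f b → HasMean g b
mean-cong {b = b} e (hasMean r p u l) = hasMean r p
  (λ N → subst (_≤ b * E N) (X-cong e N) (u N))
  (λ N → subst (λ z → b * E N ≤ z + r N) (X-cong e N) (l N))

mean-fall : ∀ k → HasMean (λ q → fall q k) 1
mean-fall k = hasMean (λ N → k * suc N ^ k) (k , k , λ N → ≤-refl)
  (λ N → subst (X N (λ q → fall q k) ≤_) (sym (+-identityʳ (E N))) (X-fall-≤ k N))
  (λ N → subst (_≤ X N (λ q → fall q k) + k * suc N ^ k) (sym (+-identityʳ (E N))) (E≤X-fall k N))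

mean-+ : ∀ {f g b c} → HasMean f b → HasMean g c → HasMean (λ q → f q + g q) (b + c)
mean-+ {f} {g} {b} {c} (hasMean r p u l) (hasMean r′ p′ u′ l′) = hasMean (λ N → r N + r′ N) (poly-+ p p′)
  (λ N → ≤-congˡʳ (X-+ f g N) (+-mono-≤ (u N) (u′ N)) (*-distribʳ-+ (E N) b c))
  (λ N → ≤-trans (≤-reflexive (*-distribʳ-+ (E N) b c)) (≤-trans (+-mono-≤ (l N) (l′ N))
    (≤-reflexive (trans (lemma (X N f) (r N) (X N g) (r′ N)) (cong (_+ (r N + r′ N)) (sym (X-+ f g N)))))))
  where
  lemma : ∀ a b c d → a + b + (c + d) ≡ a + c + (b + d)
  lemma = solve-∀

mean-* : ∀ c {f b} → HasMean f b → HasMean (λ q → c * f q) (c * b)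
mean-* c {f} {b} (hasMean r p u l) = hasMean (λ N → c * r N) (poly-* c p)
  (λ N → ≤-congˡʳ (X-* c f N) (*-monoʳ-≤ c (u N)) (*-assoc c b (E N)))
  (λ N → ≤-trans (≤-reflexive (*-assoc c b (E N))) (≤-trans (*-monoʳ-≤ c (l N))
     (≤-reflexive (trans (*-distribˡ-+ c (X N f) (r N)) (cong (_+ c * r N) (sym (X-* c f N)))))))

mean-0 : HasMean (λ _ → 0) 0
mean-0 = hasMean (λ _ → 0) (0 , 0 , λ N → z≤n) (λ N → ≤-reflexive (X-* 0 (λ _ → 0) N)) (λ N → z≤n)

mean-sumTo : ∀ n (f : ℕ → ℕ → ℕ) b → (∀ k → HasMean (f k) (b k)) → HasMean (λ q → sumTo n (λ k → f k q)) (sumTo n b)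
mean-sumTo zero    f b m = mean-0
mean-sumTo (suc n) f b m = mean-+ (mean-sumTo n f b m) (m (suc n))

sumTo-cong : ∀ n {f g} → f ≗ g → sumTo n f ≡ sumTo n g
sumTo-cong zero    e = refl
sumTo-cong (suc n) e = cong₂ _+_ (sumTo-cong n e) (e (suc n))

sumTo-* : ∀ n c f → c * sumTo n f ≡ sumTo n (λ k → c * f k)
sumTo-* zero    c f = *-zeroʳ c
sumTo-* (suc n) c f = trans (*-distribˡ-+ c (sumTo n f) _) (cong (_+ c * f (suc n)) (sumTo-* n c f))

sumTo-+ : ∀ n f g → sumTo n (λ k → f k + g k) ≡ sumTo n f + sumTo n g
sumTo-+ zero    f g = refl
sumTo-+ (suc n) f g = trans (cong (_+ (f (suc n) + g (suc n))) (sumTo-+ n f g))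
  (lemma (sumTo n f) (sumTo n g) (f (suc n)) (g (suc n)))
  where
  lemma : ∀ a b c d → a + b + (c + d) ≡ a + c + (b + d)
  lemma = solve-∀

fallSum : ℕ → (ℕ → ℕ) → ℕ → ℕ
fallSum n s q = sumTo n (λ k → s k * fall q k)

mean-fallSum : ∀ n s → HasMean (fallSum n s) (sumTo n s)
mean-fallSum n s = subst (HasMean _) (sumTo-cong n (λ k → *-identityʳ (s k)))
  (mean-sumTo n _ _ (λ k → mean-* (s k) (mean-fall k)))

mean-q*fallSum : ∀ n s → HasMean (λ q → q * fallSum n s q) (sumTo n s + sumTo n (λ k → k * s k))
mean-q*fallSum n s = mean-cong eq
  (subst (HasMean _) (trans (sumTo-cong n (λ k → lemma₁ (s k) k)) (sumTo-+ n s _))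
    (mean-sumTo n _ _ (λ k → mean-* (s k) (mean-+ (mean-fall (suc k)) (mean-* k (mean-fall k))))))
  where
  lemma₁ : ∀ s k → s * (1 + k * 1) ≡ s + k * s
  lemma₁ = solve-∀
  lemma₂ : ∀ s q f → s * (q * f) ≡ q * (s * f)
  lemma₂ = solve-∀
  eq : ∀ q → sumTo n (λ k → s k * (fall q (suc k) + k * fall q k)) ≡ q * fallSum n s q
  eq q = trans (sumTo-cong n (λ k → trans (cong (s k *_) (sym (*-fall q k))) (lemma₂ (s k) q (fall q k))))
               (sym (sumTo-* n q _))

-- Chebyshev's correlation inequality for truncated Poisson sums

infix 4 _⊒_ _⊐_

-- Likelihood ratio order: wherever it is defined, P / Q is nondecreasing.
record _⊒_ (P Q : ℕ → ℕ) : Set where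
  constructor mono
  field ratio-≤ : ∀ {i j} → i < j → P i * Q j ≤ P j * Q i

open _⊒_ public

-- Every ratio that has to increase strictly already does so between 3 and 4.
record _⊐_ (P Q : ℕ → ℕ) : Set where
  constructor mono<
  field ratio-< : P 3 * Q 4 < P 4 * Q 3

open _⊐_ public

-- The surplus of `X N P* * X N Q` over `X N P * X N Q*` is a weighted sum, over pairs `x < M ≤ N`,
-- of `(M - x) (P M · Q x - P x · Q M)`, which is nonnegative. `term` treats one pair, `Cross M δ N`
-- the pairs of `M` with all `x ≤ N`, and `Cov N δ` all pairs; `δ` is a lower bound for the surplus.
module Chebyshev (P Q : ℕ → ℕ) (P⊒Q : P ⊒ Q) where

  P* Q* : ℕ → ℕ
  P* q = q * P q
  Q* q = q * Q q

  term : ∀ x M δ → x ≤ M → P x * Q M + δ ≤ P M * Q x →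
         P x * Q* M + P M * Q* x + (M ∸ x) * δ ≤ P* x * Q M + P* M * Q x
  term x M δ x≤M le = ≤-congˡʳ
    (trans (cong (λ m → P x * (m * Q M) + P M * Q* x + (M ∸ x) * δ) (sym (m∸n+n≡m x≤M)))
           (lemma₁ (P x) (P M) (Q x) (Q M) x (M ∸ x) δ))
    (+-monoʳ-≤ (x * (P x * Q M) + x * (P M * Q x)) (*-monoʳ-≤ (M ∸ x) le))
    (trans (cong (λ m → P* x * Q M + m * P M * Q x) (sym (m∸n+n≡m x≤M)))
           (lemma₂ (P x) (P M) (Q x) (Q M) x (M ∸ x)))
    where
    lemma₁ : ∀ p p′ q q′ x e δ → p * ((e + x) * q′) + p′ * (x * q) + e * δ ≡ x * (p * q′) + x * (p′ * q) + e * (p * q′ + δ)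
    lemma₁ = solve-∀
    lemma₂ : ∀ p p′ q q′ x e → x * p * q′ + (e + x) * p′ * q ≡ x * (p * q′) + x * (p′ * q) + e * (p′ * q)
    lemma₂ = solve-∀

  term₀ : ∀ x M → x < M → P x * Q* M + P M * Q* x ≤ P* x * Q M + P* M * Q x
  term₀ x M x<M = ≤-trans (m≤m+n _ _)
    (term x M 0 (<⇒≤ x<M) (≤-trans (≤-reflexive (+-identityʳ _)) (ratio-≤ P⊒Q x<M)))

  Cross : ℕ → ℕ → ℕ → Set
  Cross M δ N = X N P * Q* M + P M * X N Q* + δ ≤ X N P* * Q M + P* M * X N Q

  private
    cross-step : ∀ M δ δ′ N → P (suc N) * Q* M + P M * Q* (suc N) + δ′ ≤ P* (suc N) * Q M + P* M * Q (suc N) →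
                 Cross M δ N → Cross M (suc N * δ + δ′) (suc N)
    cross-step M δ δ′ N t c = ≤-congˡʳ
      (lemma₁ (suc N) (X N P) (P (suc N)) (Q* M) (P M) (X N Q*) (Q* (suc N)) δ δ′)
      (+-mono-≤ (*-monoʳ-≤ (suc N) c) t)
      (lemma₂ (suc N) (X N P*) (P* (suc N)) (Q M) (P* M) (X N Q) (Q (suc N)))
      where
      lemma₁ : ∀ n x p q m y r δ δ′ → (n * x + p) * q + m * (n * y + r) + (n * δ + δ′)
               ≡ n * (x * q + m * y + δ) + (p * q + m * r + δ′)
      lemma₁ = solve-∀
      lemma₂ : ∀ n x p q m y r → (n * x + p) * q + m * (n * y + r) ≡ n * (x * q + m * y) + (p * q + m * r)
      lemma₂ = solve-∀

  cross : ∀ M N → N < M → Cross M 0 N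
  cross M zero    N<M = ≤-trans (≤-reflexive (+-identityʳ _)) (term₀ 0 M N<M)
  cross M (suc N) N<M = subst (λ d → Cross M d (suc N)) (trans (+-identityʳ (N * 0)) (*-zeroʳ N))
    (cross-step M 0 0 N (≤-trans (≤-reflexive (+-identityʳ _)) (term₀ (suc N) M N<M)) (cross M N (<-trans (n<1+n N) N<M)))

  Cov : ℕ → ℕ → Set
  Cov N δ = X N P * X N Q* + δ ≤ X N P* * X N Q

  -- Old pairs are rescaled by `(N+1)²` and the new cross pairs by `N+1`, the factors by which `X`
  -- grows; the diagonal pair of `N+1` with itself adds the same to both sides.
  cov-step : ∀ N δ δ′ → Cov N δ → Cross (suc N) δ′ N → Cov (suc N) (suc N * suc N * δ + suc N * δ′)
  cov-step N δ δ′ c d = ≤-congˡʳ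
    (lemma₁ (suc N) (X N P) (P (suc N)) (X N Q*) (Q (suc N)) δ δ′)
    (+-monoˡ-≤ (suc N * P (suc N) * Q (suc N)) (+-mono-≤ (*-monoʳ-≤ (suc N * suc N) c) (*-monoʳ-≤ (suc N) d)))
    (lemma₂ (suc N) (X N P*) (P (suc N)) (X N Q) (Q (suc N)))
    where
    lemma₁ : ∀ n x p y q δ δ′ → (n * x + p) * (n * y + n * q) + (n * n * δ + n * δ′)
             ≡ n * n * (x * y + δ) + n * (x * (n * q) + p * y + δ′) + n * p * q
    lemma₁ = solve-∀
    lemma₂ : ∀ n x p y q → (n * x + n * p) * (n * y + q) ≡ n * n * (x * y) + n * (x * q + n * p * y) + n * p * q
    lemma₂ = solve-∀

  cov : ∀ N → Cov N 0
  cov zero    = ≤-reflexive (trans (+-identityʳ _) (*-zeroʳ (P 0)))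
  cov (suc N) = subst (Cov (suc N)) (lemma (suc N)) (cov-step N 0 0 (cov N) (cross (suc N) N ≤-refl))
    where
    lemma : ∀ n → n * n * 0 + n * 0 ≡ 0
    lemma = solve-∀

  -- h M = (4 + M)! / 4!, the growth rate of E (4 + M).
  h : ℕ → ℕ
  h zero    = 1
  h (suc M) = (5 + M) * h M

  -- The pair (3, 4) contributes at least 1, and each later truncation step multiplies the surplus
  -- by the square of the new index, just as it does `h M * h M`.
  cov-strict : P ⊐ Q → ∀ M → Cov (4 + M) (h M * h M)
  cov-strict s zero = ≤-trans (+-monoʳ-≤ (X 4 P * X 4 Q*) (s≤s z≤n))
    (cov-step 3 0 1 (cov 3) (cross-step 4 0 1 2
      (term 3 4 1 (n≤1+n 3) (≤-trans (≤-reflexive (+-comm _ 1)) (ratio-< s))) (cross 4 2 (s≤s (s≤s (s≤s z≤n))))))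
  cov-strict s (suc M) = subst (Cov (5 + M)) (lemma (5 + M) (h M))
    (cov-step (4 + M) (h M * h M) 0 (cov-strict s M) (cross (5 + M) (4 + M) ≤-refl))
    where
    lemma : ∀ n h → n * n * (h * h) + n * 0 ≡ n * h * (n * h)
    lemma = solve-∀

  h≤E : ∀ M → h M ≤ E (4 + M)
  h≤E zero    = s≤s z≤n
  h≤E (suc M) = ≤-trans (*-monoʳ-≤ (5 + M) (h≤E M)) (m≤m+n _ 1)

  -- The constant is `E 4 + 1 = 65 + 1`. Bounding `suc (E _)` instead of `E _` lets the induction
  -- absorb the `+ 1` in the recursion of `E`.
  E<66h : ∀ M → suc (E (4 + M)) ≤ 66 * h M
  E<66h zero    = ≤-refl
  E<66h (suc M) = begin
    suc ((5 + M) * e + 1)       ≤⟨ s≤s (+-monoʳ-≤ ((5 + M) * e) (s≤s z≤n)) ⟩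
    suc ((5 + M) * e + (4 + M)) ≡⟨ lemma₁ M e ⟩
    (5 + M) * suc e             ≤⟨ *-monoʳ-≤ (5 + M) (E<66h M) ⟩
    (5 + M) * (66 * h M)        ≡⟨ lemma₂ (5 + M) (h M) ⟩
    66 * ((5 + M) * h M)        ∎
    where
    open ≤-Reasoning
    e = E (4 + M)
    lemma₁ : ∀ M e → suc ((5 + M) * e + (4 + M)) ≡ (5 + M) * suc e
    lemma₁ = solve-∀
    lemma₂ : ∀ n h → n * (66 * h) ≡ 66 * (n * h)
    lemma₂ = solve-∀

  h>0 : ∀ M → 0 < h M
  h>0 zero    = s≤s z≤n
  h>0 (suc M) = *-mono-≤ {1} {5 + M} (s≤s z≤n) (h>0 M)

  -- Each step of `M` supplies one factor `5 + M`, which pays for one more degree; replacing `6 + M`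
  -- by `2 * (5 + M)` only enlarges the constant.
  h-superpoly : ∀ d C → ∃ λ M₀ → ∀ M → M₀ ≤ M → C * (5 + M) ^ d < h M
  h-superpoly zero C = C , λ M C≤M → ≤-trans (s≤s (≤-trans (≤-reflexive (*-identityʳ C)) C≤M)) (go M)
    where
    go : ∀ M → M < h M
    go zero    = s≤s z≤n
    go (suc M) = begin
      suc (suc M)   ≤⟨ s≤s (go M) ⟩
      1 + h M       ≤⟨ +-monoˡ-≤ (h M) (h>0 M) ⟩
      h M + h M     ≤⟨ +-monoʳ-≤ (h M) (m≤m+n (h M) _) ⟩
      (5 + M) * h M ∎
      where open ≤-Reasoning
  h-superpoly (suc d) C with h-superpoly d (C * 2 ^ suc d)
  ... | M₀ , big = suc M₀ , λ { (suc M) (s≤s le) → begin-strict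
    C * (6 + M) ^ suc d                 ≤⟨ *-monoʳ-≤ C (^-monoˡ-≤ (suc d) (dbl M)) ⟩
    C * (2 * (5 + M)) ^ suc d           ≡⟨ cong (C *_) (^-distribʳ-* (suc d) 2 (5 + M)) ⟩
    C * (2 ^ suc d * (5 + M) ^ suc d)   ≡⟨ lemma C (2 ^ suc d) (5 + M) ((5 + M) ^ d) ⟩
    (5 + M) * (C * 2 ^ suc d * (5 + M) ^ d) <⟨ *-monoʳ-< (5 + M) (big M le) ⟩
    h (suc M)                           ∎ }
    where
    open ≤-Reasoning
    dbl : ∀ M → 6 + M ≤ 2 * (5 + M)
    dbl M = ≤-trans (m≤m+n (6 + M) (4 + M)) (≤-reflexive (lemma′ M))
      where
      lemma′ : ∀ M → 6 + M + (4 + M) ≡ 2 * (5 + M)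
      lemma′ = solve-∀
    lemma : ∀ C p n r → C * (p * (n * r)) ≡ n * (C * p * r)
    lemma = solve-∀

  module _ {b c b′ c′} (p : HasMean P b) (q : HasMean Q c) (p* : HasMean P* b′) (q* : HasMean Q* c′) where
    private
      module p = HasMean p
      module q = HasMean q
      module p* = HasMean p*
      module q* = HasMean q*

      err : ℕ → ℕ
      err N = b * q*.err N + c′ * p.err N

      product-bound : ∀ N → E N * E N * (b * c′) ≤ X N P * X N Q* + E N * err N
      product-bound N = begin
        E N * E N * (b * c′)                                ≡⟨ lemma₁ (E N) b c′ ⟩
        b * E N * (c′ * E N)                                ≤⟨ *-monoˡ-≤ (c′ * E N) (p.lower N) ⟩
        (X N P + p.err N) * (c′ * E N)                      ≡⟨ *-distribʳ-+ (c′ * E N) (X N P) (p.err N) ⟩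
        X N P * (c′ * E N) + p.err N * (c′ * E N)           ≤⟨ +-monoˡ-≤ _ (*-monoʳ-≤ (X N P) (q*.lower N)) ⟩
        X N P * (X N Q* + q*.err N) + p.err N * (c′ * E N)  ≡⟨ lemma₂ (X N P) (X N Q*) (q*.err N) (p.err N) (c′ * E N) ⟩
        X N P * X N Q* + (X N P * q*.err N + p.err N * (c′ * E N))
          ≤⟨ +-monoʳ-≤ (X N P * X N Q*) (+-monoˡ-≤ _ (*-monoˡ-≤ (q*.err N) (p.upper N))) ⟩
        X N P * X N Q* + (b * E N * q*.err N + p.err N * (c′ * E N))
          ≡⟨ cong (X N P * X N Q* +_) (lemma₃ b (E N) (q*.err N) (p.err N) c′) ⟩
        X N P * X N Q* + E N * err N                        ∎
        where
        open ≤-Reasoning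
        lemma₁ : ∀ e b c → e * e * (b * c) ≡ b * e * (c * e)
        lemma₁ = solve-∀
        lemma₂ : ∀ x y r s e → x * (y + r) + s * e ≡ x * y + (x * r + s * e)
        lemma₂ = solve-∀
        lemma₃ : ∀ b e r s c → b * e * r + s * (c * e) ≡ e * (b * r + c * s)
        lemma₃ = solve-∀

      cov-upper : ∀ N → X N P* * X N Q ≤ E N * E N * (b′ * c)
      cov-upper N = ≤-trans (*-mono-≤ (p*.upper N) (q.upper N)) (≤-reflexive (lemma b′ c (E N)))
        where
        lemma : ∀ b c e → b * e * (c * e) ≡ e * e * (b * c)
        lemma = solve-∀

      -- A surplus of `h M * h M` would have to fit into the truncation error, at most `E (4 + M)`
      -- times a polynomial. As `E (4 + M)` is below `66 * h M`, one factor `h M` cancels and `h`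
      -- would be polynomially bounded.
      impossible : ¬ (∀ M → X (4 + M) P * X (4 + M) Q* + h M * h M ≤ E (4 + M) * E (4 + M) * (b * c′))
      impossible gap with poly-+ (poly-* b q*.poly) (poly-* c′ p.poly)
      ... | C , d , err≤ with h-superpoly d (66 * C)
      ... | M , big = <-irrefl refl (<-≤-trans (big M ≤-refl) h≤)
        where
        open ≤-Reasoning
        hh≤ : h M * h M ≤ E (4 + M) * err (4 + M)
        hh≤ = +-cancelˡ-≤ _ _ _ (≤-trans (gap M) (product-bound (4 + M)))
        h≤ : h M ≤ 66 * C * (5 + M) ^ d
        h≤ = *-cancelˡ-≤ (h M) ⦃ >-nonZero (h>0 M) ⦄ (begin
          h M * h M                        ≤⟨ hh≤ ⟩
          E (4 + M) * err (4 + M)          ≤⟨ *-mono-≤ (≤-trans (n≤1+n _) (E<66h M)) (err≤ (4 + M)) ⟩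
          66 * h M * (C * (5 + M) ^ d)     ≡⟨ lemma (h M) C ((5 + M) ^ d) ⟩
          h M * (66 * C * (5 + M) ^ d)     ∎)
          where
          lemma : ∀ h C x → 66 * h * (C * x) ≡ h * (66 * C * x)
          lemma = solve-∀

    mean-mono : b * c′ ≤ b′ * c
    -- A failure is a failure by at least 1, so the scaled surplus is at least
    -- `E (4 + M) * E (4 + M)`, which dominates `h M * h M`.
    mean-mono = ≮⇒≥ λ lt → impossible λ M → begin
      X (4 + M) P * X (4 + M) Q* + h M * h M
        ≤⟨ +-mono-≤ (≤-trans (≤-trans (m≤m+n _ 0) (cov (4 + M))) (cov-upper (4 + M))) (*-mono-≤ (h≤E M) (h≤E M)) ⟩
      E (4 + M) * E (4 + M) * (b′ * c) + E (4 + M) * E (4 + M) ≡⟨ lemma (E (4 + M) * E (4 + M)) (b′ * c) ⟩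
      E (4 + M) * E (4 + M) * suc (b′ * c) ≤⟨ *-monoʳ-≤ (E (4 + M) * E (4 + M)) lt ⟩
      E (4 + M) * E (4 + M) * (b * c′) ∎
      where
      open ≤-Reasoning
      lemma : ∀ e x → e * x + e ≡ e * suc x
      lemma = solve-∀

    mean-mono-strict : P ⊐ Q → b * c′ < b′ * c
    mean-mono-strict s = ≰⇒> λ le → impossible λ M →
      ≤-trans (cov-strict s M) (≤-trans (cov-upper (4 + M)) (*-monoʳ-≤ (E (4 + M) * E (4 + M)) le))

-- `q * fallSum n s q` has mean `b` plus the weighted sum, so both sides of Chebyshev's inequality
-- contain `b * c`; cancelling it leaves the cross-multiplied averages.
averages-< : ∀ n s m t → fallSum n s ⊒ fallSum m t → fallSum n s ⊐ fallSum m t →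
             sumTo n s * sumTo m (λ k → k * t k) < sumTo n (λ k → k * s k) * sumTo m t
averages-< n s m t w st = +-cancelˡ-< (b * c) _ _ (≤-congˡʳ (cong suc (lemma₁ b c _))
  (Chebyshev.mean-mono-strict _ _ w (mean-fallSum n s) (mean-fallSum m t) (mean-q*fallSum n s) (mean-q*fallSum m t) st)
  (sym (lemma₂ b c _)))
  where
  b = sumTo n s
  c = sumTo m t
  lemma₁ : ∀ b c d → b * c + b * d ≡ b * (c + d)
  lemma₁ = solve-∀
  lemma₂ : ∀ b c d → (b + d) * c ≡ b * c + d * c
  lemma₂ = solve-∀

averages-≤ : ∀ n s m t → fallSum n s ⊒ fallSum m t →
             sumTo n s * sumTo m (λ k → k * t k) ≤ sumTo n (λ k → k * s k) * sumTo m t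
averages-≤ n s m t w = +-cancelˡ-≤ (b * c) _ _ (≤-congˡʳ (lemma₁ b c _)
  (Chebyshev.mean-mono _ _ w (mean-fallSum n s) (mean-fallSum m t) (mean-q*fallSum n s) (mean-q*fallSum m t))
  (sym (lemma₂ b c _)))
  where
  b = sumTo n s
  c = sumTo m t
  lemma₁ : ∀ b c d → b * c + b * d ≡ b * (c + d)
  lemma₁ = solve-∀
  lemma₂ : ∀ b c d → (b + d) * c ≡ b * c + d * c
  lemma₂ = solve-∀

-- Paths and cycles against edgeless graphs

infixr 7 _⊗_

_⊗_ : (ℕ → ℕ) → (ℕ → ℕ) → ℕ → ℕ
(P ⊗ Q) q = P q * Q q

⊒-refl : ∀ {P} → P ⊒ P
⊒-refl {P} = mono λ {i} {j} _ → ≤-reflexive (*-comm (P i) (P j))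

⊒-cong : ∀ {P P′ Q Q′} → P ≗ P′ → Q ≗ Q′ → P ⊒ Q → P′ ⊒ Q′
⊒-cong e e′ (mono le) = mono λ {i} {j} i<j → subst₂ _≤_ (cong₂ _*_ (e i) (e′ j)) (cong₂ _*_ (e j) (e′ i)) (le i<j)

⊐-cong : ∀ {P P′ Q Q′} → P ≗ P′ → Q ≗ Q′ → P ⊐ Q → P′ ⊐ Q′
⊐-cong e e′ (mono< lt) = mono< (subst₂ _<_ (cong₂ _*_ (e 3) (e′ 4)) (cong₂ _*_ (e 4) (e′ 3)) lt)

interchange : ∀ a b c d → (a * b) * (c * d) ≡ (a * c) * (b * d)
interchange = solve-∀

⊒-⊗ : ∀ {P P′ Q Q′} → P ⊒ Q → P′ ⊒ Q′ → (P ⊗ P′) ⊒ (Q ⊗ Q′)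
⊒-⊗ {P} {P′} {Q} {Q′} (mono l) (mono l′) = mono λ {i} {j} i<j → ≤-congˡʳ
  (interchange (P i) (P′ i) (Q j) (Q′ j))
  (*-mono-≤ (l i<j) (l′ i<j))
  (interchange (P j) (P′ j) (Q i) (Q′ i))

⊐-⊗ : ∀ {P P′ Q Q′} → P ⊐ Q → P′ ⊒ Q′ → 0 < P′ 4 → 0 < Q′ 3 → (P ⊗ P′) ⊐ (Q ⊗ Q′)
⊐-⊗ {P} {P′} {Q} {Q′} (mono< s) (mono l) p q = mono< (≤-congˡʳ
  (cong suc (interchange (P 3) (P′ 3) (Q 4) (Q′ 4)))
  (≤-<-trans (*-monoʳ-≤ (P 3 * Q 4) (l (n<1+n 3)))
    (*-monoˡ-< (P′ 4 * Q′ 3) ⦃ >-nonZero (*-mono-≤ p q) ⦄ s))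
  (interchange (P 4) (P′ 4) (Q 3) (Q′ 3)))

pow : ℕ → ℕ → ℕ
pow M q = q ^ M

∸⊒id : ∀ c → (λ q → q ∸ c) ⊒ (λ q → q)
∸⊒id c = mono λ {i} {j} i<j → ≤-congˡʳ (*-distribʳ-∸ j i c)
  (≤-trans (≤-reflexive (cong (_∸ c * j) (*-comm i j))) (∸-monoʳ-≤ (j * i) (*-monoʳ-≤ c (<⇒≤ i<j))))
  (*-distribʳ-∸ i j c)

pred⊐id : (λ q → q ∸ 1) ⊐ (λ q → q)
pred⊐id = mono< (s≤s ≤-refl)

-- Below 2 the left side vanishes; from 2 on the one-step inequalities are chained. Transitivity of
-- the ratio order costs a factor `(2 + j) ^ M`, which is positive and is cancelled.
⊒-pow-from-2 : ∀ f M → f 0 ≡ 0 → f 1 ≡ 0 →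
  (∀ z → f (2 + z) * (3 + z) ^ M ≤ f (3 + z) * (2 + z) ^ M) → f ⊒ pow M
⊒-pow-from-2 f M e₀ e₁ step = mono λ {i} {j} → le i j
  where
  open ≤-Reasoning
  lemma : ∀ a b c → a * b * c ≡ a * c * b
  lemma = solve-∀
  go : ∀ i d → f (2 + i) * (3 + (d + i)) ^ M ≤ f (3 + (d + i)) * (2 + i) ^ M
  go i zero    = step i
  go i (suc d) = *-cancelʳ-≤ _ _ ((2 + j) ^ M) ⦃ >-nonZero (m^n>0 (2 + j) M) ⦄ (begin
    f (2 + i) * (3 + j) ^ M * (2 + j) ^ M ≡⟨ lemma (f (2 + i)) _ _ ⟩
    f (2 + i) * (2 + j) ^ M * (3 + j) ^ M ≤⟨ *-monoˡ-≤ ((3 + j) ^ M) (go i d) ⟩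
    f (2 + j) * (2 + i) ^ M * (3 + j) ^ M ≡⟨ lemma (f (2 + j)) _ _ ⟩
    f (2 + j) * (3 + j) ^ M * (2 + i) ^ M ≤⟨ *-monoˡ-≤ ((2 + i) ^ M) (step j) ⟩
    f (3 + j) * (2 + j) ^ M * (2 + i) ^ M ≡⟨ lemma (f (3 + j)) _ _ ⟩
    f (3 + j) * (2 + i) ^ M * (2 + j) ^ M ∎)
    where j = suc d + i
  le : ∀ i j → i < j → f i * j ^ M ≤ f j * i ^ M
  le zero          j i<j = subst (λ z → z * j ^ M ≤ f j * 0 ^ M) (sym e₀) z≤n
  le (suc zero)    j i<j = subst (λ z → z * j ^ M ≤ f j * 1 ^ M) (sym e₁) z≤n
  le (suc (suc i)) j i<j = subst (λ j → f (2 + i) * j ^ M ≤ f j * (2 + i) ^ M)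
    (trans (lemma′ (j ∸ (3 + i)) i) (m∸n+n≡m i<j)) (go i (j ∸ (3 + i)))
    where
    lemma′ : ∀ d i → 3 + (d + i) ≡ d + (3 + i)
    lemma′ = solve-∀

-- The forward difference of `x ^ N`, by a recursion free of subtraction that makes it visibly
-- monotone in `x`; this is the convexity of powers.
δ^ : ℕ → ℕ → ℕ
δ^ zero    x = 0
δ^ (suc N) x = x ^ N + suc x * δ^ N x

^-δ : ∀ N x → suc x ^ N ≡ x ^ N + δ^ N x
^-δ zero    x = refl
^-δ (suc N) x = trans (cong (suc x *_) (^-δ N x)) (lemma x (x ^ N) (δ^ N x))
  where
  lemma : ∀ x p d → suc x * (p + d) ≡ x * p + (p + suc x * d)
  lemma = solve-∀

δ^-mono : ∀ N {x z} → x ≤ z → δ^ N x ≤ δ^ N z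
δ^-mono zero    le = z≤n
δ^-mono (suc N) le = +-mono-≤ (^-monoˡ-≤ N le) (*-mono-≤ (s≤s le) (δ^-mono N le))

^-convex : ∀ N x z → x ≤ z → suc x ^ N + z ^ N ≤ suc z ^ N + x ^ N
^-convex N x z le = ≤-congˡʳ
  (trans (cong (_+ z ^ N) (^-δ N x)) (lemma (x ^ N) (δ^ N x) (z ^ N)))
  (+-monoʳ-≤ (x ^ N + z ^ N) (δ^-mono N le))
  (trans (cong (_+ x ^ N) (^-δ N z)) (lemma′ (x ^ N) (z ^ N) (δ^ N z)))
  where
  lemma : ∀ x d z → x + d + z ≡ x + z + d
  lemma = solve-∀
  lemma′ : ∀ x z d → z + d + x ≡ x + z + d
  lemma′ = solve-∀

^-convex-< : ∀ N x z → x < z → suc x ^ (2 + N) + z ^ (2 + N) < suc z ^ (2 + N) + x ^ (2 + N)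
^-convex-< N x z lt = ≤-congˡʳ
  (cong suc (trans (cong (_+ z ^ M) (^-δ M x)) (lemma (x ^ M) (δ^ M x) (z ^ M))))
  (+-monoʳ-< (x ^ M + z ^ M) (+-mono-<-≤ (^-monoˡ-< (1 + N) lt) (*-mono-≤ (s≤s (<⇒≤ lt)) (δ^-mono (1 + N) (<⇒≤ lt)))))
  (trans (cong (_+ x ^ M) (^-δ M z)) (lemma′ (x ^ M) (z ^ M) (δ^ M z)))
  where
  M = 2 + N
  lemma : ∀ x d z → x + d + z ≡ x + z + d
  lemma = solve-∀
  lemma′ : ∀ x z d → z + d + x ≡ x + z + d
  lemma′ = solve-∀

-- Chromatic polynomials of cycles

double : ℕ → ℕ
double zero    = 0
double (suc k) = 2 + double k

-- The chromatic polynomial of the even cycle C_{4+2k} is (q-1) (evenFactor k q), and that of the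
-- odd cycle C_{3+2k} is q (q-1) (q-2) (oddFactor k q).  For q < 2, where the cofactors vanish,
-- the factors are set to 0: only then are their ratios to powers of q monotone.
evenFactor : ℕ → ℕ → ℕ
evenFactor k zero          = 0
evenFactor k (suc zero)    = 0
evenFactor k (suc (suc z)) = suc z ^ (3 + double k) + 1

evenPowerSum : ℕ → ℕ → ℕ
evenPowerSum zero    y = 1
evenPowerSum (suc k) y = y * y * evenPowerSum k y + 1

oddFactor : ℕ → ℕ → ℕ
oddFactor k zero          = 0
oddFactor k (suc zero)    = 0
oddFactor k (suc (suc z)) = evenPowerSum k (suc z)

data CycleParity : Set where
  odd even : ℕ → CycleParity

cycleLength : CycleParity → ℕ
cycleLength (odd k)  = 3 + double k
cycleLength (even k) = 4 + double k

cyclePoly : CycleParity → ℕ → ℕ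
cyclePoly (odd k)  = (λ q → fall q 3) ⊗ oddFactor k
cyclePoly (even k) = (λ q → q ∸ 1) ⊗ evenFactor k

-- The geometric series of ratio `y²` for `y = suc z`; `z * (2 + z)` is `y² - 1`.
evenPowerSum-geometric : ∀ k z → z * (2 + z) * evenPowerSum k (suc z) + 1 ≡ suc z * (suc z * suc z ^ double k)
evenPowerSum-geometric zero    z = lemma z
  where
  lemma : ∀ z → z * (2 + z) * 1 + 1 ≡ suc z * (suc z * 1)
  lemma = solve-∀
evenPowerSum-geometric (suc k) z =
  trans (lemma z (evenPowerSum k (suc z)))
        (cong (λ w → suc z * (suc z * w)) (evenPowerSum-geometric k z))
  where
  lemma : ∀ z d → z * (2 + z) * (suc z * suc z * d + 1) + 1 ≡ suc z * (suc z * (z * (2 + z) * d + 1))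
  lemma = solve-∀

-- With `q = 2 + z`, expanding leaves `(q²-1)^N + (q+1)^N ≤ (q²)^N + q^N`. This is convexity of
-- `t^N`: the unit step from `q` is compared with the one from `q² - 1`, and `q ≤ q² - 1`.
evenFactor-step : ∀ k z → evenFactor k (2 + z) * (3 + z) ^ (3 + double k) ≤ evenFactor k (3 + z) * (2 + z) ^ (3 + double k)
evenFactor-step k z = ≤-congˡʳ
  (trans (lemma (suc z ^ N) ((3 + z) ^ N)) (cong (_+ (3 + z) ^ N) (sym (^-distribʳ-* N (suc z) (3 + z)))))
  (≤-trans (≤-reflexive (+-comm ((suc z * (3 + z)) ^ N) ((3 + z) ^ N))) (^-convex N (2 + z) (suc z * (3 + z)) (≤-trans (m≤m+n _ _) (≤-reflexive (lemma₁ z)))))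
  (trans (lemma ((2 + z) ^ N) ((2 + z) ^ N)) (cong (_+ (2 + z) ^ N)
    (trans (sym (^-distribʳ-* N (2 + z) (2 + z))) (cong (_^ N) (lemma₂ z)))))
  where
  N = 3 + double k
  lemma : ∀ a b → (a + 1) * b ≡ a * b + b
  lemma = solve-∀
  lemma₁ : ∀ z → 2 + z + (z * z + 3 * z + 1) ≡ suc z * (3 + z)
  lemma₁ = solve-∀
  lemma₂ : ∀ z → (2 + z) * (2 + z) ≡ suc (suc z * (3 + z))
  lemma₂ = solve-∀

evenFactor⊒ : ∀ k → evenFactor k ⊒ pow (3 + double k)
evenFactor⊒ k = ⊒-pow-from-2 (evenFactor k) (3 + double k) refl refl (evenFactor-step k)

evenFactor>0 : ∀ k z → 0 < evenFactor k (2 + z)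
evenFactor>0 k z = m≤n+m 1 _

evenPowerSum>0 : ∀ k y → 0 < evenPowerSum k y
evenPowerSum>0 zero    y = s≤s z≤n
evenPowerSum>0 (suc k) y = m≤n+m 1 _

module OddStep (z : ℕ) where
  y = suc z

  -- The slack consumed by `step<`. For `k ≥ 1` the bound `evenPowerSum k y ≥ y² + 1` is enough; for
  -- `k = 0` the last summand has to help, and `y ≥ 1`, that is `q ≥ 2`, matters.
  gain : ∀ k → (2 + y) * (2 + y) * (2 + y) ^ double k
             < (1 + 2 * (y * (2 + y))) * (evenPowerSum k y * (2 + y) ^ double k) + (1 + y) * (1 + y) * (1 + y) ^ double k
  gain zero = ≤-trans (m≤m+n _ _) (≤-reflexive (lemma z))
    where
    lemma : ∀ z → 1 + (2 + suc z) * (2 + suc z) * 1 + (2 * z * z + 6 * z + 1) ≡ (1 + 2 * (suc z * (2 + suc z))) * (1 * 1) + (1 + suc z) * (1 + suc z) * 1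
    lemma = solve-∀
  gain (suc k) = begin-strict
    (2 + y) * (2 + y) * p                      ≤⟨ *-monoˡ-≤ p (≤-trans (m≤m+n ((2 + y) * (2 + y)) _) (≤-reflexive (lemma z))) ⟩
    c * (y * y * 1 + 1) * p                    ≤⟨ *-monoˡ-≤ p {c * (y * y * 1 + 1)} (*-monoʳ-≤ c (+-monoˡ-≤ 1 (*-monoʳ-≤ (y * y) (evenPowerSum>0 k y)))) ⟩
    c * evenPowerSum (suc k) y * p             ≡⟨ *-assoc c (evenPowerSum (suc k) y) p ⟩
    c * (evenPowerSum (suc k) y * p)           <⟨ m<m+n _ (*-mono-≤ {1} {(1 + y) * (1 + y)} (s≤s z≤n) (m^n>0 (1 + y) (double (suc k)))) ⟩
    c * (evenPowerSum (suc k) y * p) + (1 + y) * (1 + y) * (1 + y) ^ double (suc k) ∎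
    where
    open ≤-Reasoning
    p = (2 + y) ^ double (suc k)
    c = 1 + 2 * (y * (2 + y))
    lemma : ∀ z → (2 + suc z) * (2 + suc z) + (2 * z * z * z * z + 12 * z * z * z + 26 * z * z + 24 * z + 5) ≡ (1 + 2 * (suc z * (2 + suc z))) * (suc z * suc z * 1 + 1)
    lemma = solve-∀

  step  : ∀ k → evenPowerSum k y * (2 + y) ^ double k ≤ evenPowerSum k (1 + y) * (1 + y) ^ double k
  step< : ∀ k → evenPowerSum (suc k) y * (2 + y) ^ double (suc k) < evenPowerSum (suc k) (1 + y) * (1 + y) ^ double (suc k)

  step zero    = ≤-refl
  step (suc k) = <⇒≤ (step< k)

  -- (y+1)⁴ = A² + 2A + 1 for A = y (y+2).
  step< k = begin-strict
    evenPowerSum (suc k) y * (2 + y) ^ double (suc k)             ≡⟨ lemma₁ y d p ⟩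
    a * a * (d * p) + (2 + y) * (2 + y) * p                       <⟨ +-monoʳ-< (a * a * (d * p)) (gain k) ⟩
    a * a * (d * p) + ((1 + 2 * a) * (d * p) + (1 + y) * (1 + y) * r) ≡⟨ lemma₂ y (d * p) r ⟩
    (1 + y) * (1 + y) * ((1 + y) * (1 + y) * (d * p) + r)         ≤⟨ *-monoʳ-≤ ((1 + y) * (1 + y)) (+-monoˡ-≤ r (*-monoʳ-≤ ((1 + y) * (1 + y)) (step k))) ⟩
    (1 + y) * (1 + y) * ((1 + y) * (1 + y) * (d′ * r) + r)        ≡⟨ lemma₃ (1 + y) d′ r ⟩
    evenPowerSum (suc k) (1 + y) * (1 + y) ^ double (suc k)       ∎
    where
    open ≤-Reasoning
    d = evenPowerSum k y
    d′ = evenPowerSum k (1 + y)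
    p = (2 + y) ^ double k
    r = (1 + y) ^ double k
    a = y * (2 + y)
    lemma₁ : ∀ y d p → (y * y * d + 1) * ((2 + y) * ((2 + y) * p)) ≡ y * (2 + y) * (y * (2 + y)) * (d * p) + (2 + y) * (2 + y) * p
    lemma₁ = solve-∀
    lemma₂ : ∀ y w r → y * (2 + y) * (y * (2 + y)) * w + ((1 + 2 * (y * (2 + y))) * w + (1 + y) * (1 + y) * r) ≡ (1 + y) * (1 + y) * ((1 + y) * (1 + y) * w + r)
    lemma₂ = solve-∀
    lemma₃ : ∀ x d r → x * x * (x * x * (d * r) + r) ≡ (x * x * d + 1) * (x * (x * r))
    lemma₃ = solve-∀

oddFactor⊒ : ∀ k → oddFactor k ⊒ pow (double k)
oddFactor⊒ k = ⊒-pow-from-2 (oddFactor k) (double k) refl refl (λ z → OddStep.step z k)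

-- For the triangle the factor is constant from 2 on, so strictness starts with the 5-cycle. The
-- argument 1 is the `z` for which `q = 2 + z` is 3.
oddFactor⊐ : ∀ k → oddFactor (suc k) ⊐ pow (double (suc k))
oddFactor⊐ k = mono< (OddStep.step< 1 k)

fall3⊒ : (λ q → fall q 3) ⊒ pow 3
fall3⊒ = ⊒-cong (λ q → lemma₁ q (q ∸ 1) (q ∸ 2) (q ∸ 1 ∸ 1) (sym (∸-+-assoc q 1 1))) lemma₂
  (⊒-⊗ (⊒-refl {λ q → q}) (⊒-⊗ (∸⊒id 1) (∸⊒id 2)))
  where
  lemma₁ : ∀ a b c d → c ≡ d → a * (b * c) ≡ a * (b * (d * 1))
  lemma₁ a b c _ refl = cong (λ z → a * (b * z)) (sym (*-identityʳ c))
  lemma₂ : ∀ a → a * (a * a) ≡ a * (a * (a * 1))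
  lemma₂ = solve-∀

pow-+ : ∀ a b q → (pow a ⊗ pow b) q ≡ pow (a + b) q
pow-+ a b q = sym (^-distribˡ-+-* q a b)

cycle⊒ : ∀ l → cyclePoly l ⊒ pow (cycleLength l)
cycle⊒ (odd k)  = ⊒-cong (λ _ → refl) (pow-+ 3 (double k)) (⊒-⊗ fall3⊒ (oddFactor⊒ k))
cycle⊒ (even k) = ⊒-⊗ (∸⊒id 1) (evenFactor⊒ k)

cycle⊐ : ∀ l → cyclePoly l ⊐ pow (cycleLength l)
cycle⊐ (odd k)  = ⊐-cong (λ _ → refl) (pow-+ 3 (double k))
  (⊐-⊗ {λ q → fall q 3} {Q = pow 3} (mono< (toWitness {a? = fall 3 3 * 4 ^ 3 <? fall 4 3 * 3 ^ 3} _)) (oddFactor⊒ k) (evenPowerSum>0 k 3) (m^n>0 3 (double k)))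
cycle⊐ (even k) = ⊐-⊗ pred⊐id (evenFactor⊒ k) (evenFactor>0 k 2) (m^n>0 3 (3 + double k))

cyclePoly>0 : ∀ l z → 0 < cyclePoly l (3 + z)
cyclePoly>0 (odd k)  z = *-mono-≤ {1} {fall (3 + z) 3} (s≤s z≤n) (evenPowerSum>0 k (2 + z))
cyclePoly>0 (even k) z = *-mono-≤ {1} {2 + z} (s≤s z≤n) (evenFactor>0 k (1 + z))

-- The inequality of `evenFactor-step` at `q = 3` becomes `8^N + 4^N < 9^N + 3^N`, and the exponent
-- is large enough for strict convexity.
evenFactor⊐ : ∀ k → evenFactor k ⊐ pow (3 + double k)
evenFactor⊐ k = mono< (≤-congˡʳ
  (cong suc (trans (lemma (2 ^ N) (4 ^ N)) (cong (_+ 4 ^ N) (sym (^-distribʳ-* N 2 4)))))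
  (≤-trans (≤-reflexive (cong suc (+-comm (8 ^ N) (4 ^ N)))) (^-convex-< (1 + double k) 3 8 (s≤s (s≤s (s≤s (s≤s z≤n))))))
  (trans (lemma (3 ^ N) (3 ^ N)) (cong (_+ 3 ^ N) (sym (^-distribʳ-* N 3 3)))))
  where
  N = 3 + double k
  lemma : ∀ a b → (a + 1) * b ≡ a * b + b
  lemma = solve-∀

grow : CycleParity → CycleParity
grow (odd k)  = even k
grow (even k) = odd (suc k)

cycleLength-grow : ∀ l → cycleLength (grow l) ≡ suc (cycleLength l)
cycleLength-grow (odd k)  = refl
cycleLength-grow (even k) = refl

-- Deletion and contraction of one edge of the longer cycle: deletion leaves a path on
-- `cycleLength l + 1` vertices, contraction the shorter cycle.
cyclePoly-grow : ∀ l y → cyclePoly (grow l) (suc y) + cyclePoly l (suc y) ≡ suc y * y ^ cycleLength l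
cyclePoly-grow l zero = lemma l
  where
  lemma : ∀ l → cyclePoly (grow l) 1 + cyclePoly l 1 ≡ 1 * 0 ^ cycleLength l
  lemma (odd k)  = refl
  lemma (even k) = refl
cyclePoly-grow (odd k) (suc z) = trans (lemma₁ z (suc z ^ double k) (evenPowerSum k (suc z)))
  (trans (cong (λ w → suc z * (suc z * (suc z * (suc z * suc z ^ double k)) + w)) (evenPowerSum-geometric k z))
         (lemma₂ z (suc z ^ double k)))
  where
  lemma₁ : ∀ z p d → suc z * (suc z * (suc z * (suc z * p)) + 1) + (2 + z) * (suc z * (z * 1)) * d
         ≡ suc z * (suc z * (suc z * (suc z * p)) + (z * (2 + z) * d + 1))
  lemma₁ = solve-∀
  lemma₂ : ∀ z p → suc z * (suc z * (suc z * (suc z * p)) + suc z * (suc z * p)) ≡ (2 + z) * (suc z * (suc z * (suc z * p)))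
  lemma₂ = solve-∀
cyclePoly-grow (even k) (suc z) = trans (lemma₁ z (suc z ^ double k) (evenPowerSum (suc k) (suc z)))
  (trans (cong (λ w → suc z * (suc z * (suc z * (suc z * suc z ^ double k)) + w)) (evenPowerSum-geometric (suc k) z))
         (lemma₂ z (suc z ^ double k)))
  where
  lemma₁ : ∀ z p d → (2 + z) * (suc z * (z * 1)) * d + suc z * (suc z * (suc z * (suc z * p)) + 1)
         ≡ suc z * (suc z * (suc z * (suc z * p)) + (z * (2 + z) * d + 1))
  lemma₁ = solve-∀
  lemma₂ : ∀ z p → suc z * (suc z * (suc z * (suc z * p)) + suc z * (suc z * (suc z * (suc z * p))))
         ≡ (2 + z) * (suc z * (suc z * (suc z * (suc z * p))))
  lemma₂ = solve-∀

-- Chromatic polynomials and vertex deletion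

bool-ext : ∀ {a b} → (a ≡ true → b ≡ true) → (b ≡ true → a ≡ true) → a ≡ b
bool-ext {false} {false} f g = refl
bool-ext {false} {true}  f g = g refl
bool-ext {true}  {_}     f g = sym (f refl)

∧-true : ∀ {a b} → a ∧ b ≡ true → a ≡ true × b ≡ true
∧-true {true} {true} _ = refl , refl

true-∧ : ∀ {a b} → a ≡ true → b ≡ true → a ∧ b ≡ true
true-∧ refl refl = refl

∨-true : ∀ {a b} → a ∨ b ≡ true → a ≡ true ⊎ b ≡ true
∨-true {true}  _ = inj₁ refl
∨-true {false} e = inj₂ e

true-∨ : ∀ {a b} → a ≡ true ⊎ b ≡ true → a ∨ b ≡ true
true-∨ {true}  _        = refl
true-∨ {false} (inj₂ e) = e

does-true : ∀ {A : Set} (d : Dec A) → does d ≡ true → A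
does-true (yes a) _ = a

notDoes-true : ∀ {A : Set} (d : Dec A) → not (does d) ≡ true → ¬ A
notDoes-true (no ¬a) _ = ¬a

true-notDoes : ∀ {A : Set} (d : Dec A) → ¬ A → not (does d) ≡ true
true-notDoes (yes a) ¬a = ⊥-elim (¬a a)
true-notDoes (no _)  _  = refl

all-allFin : ∀ {n} (p : Fin n → Bool) → all p (allFin n) ≡ true → ∀ i → p i ≡ true
all-allFin p = go p id
  where
  go : ∀ {n m} (p : Fin m → Bool) (f : Fin n → Fin m) → all p (List.tabulate f) ≡ true → ∀ i → p (f i) ≡ true
  go p f e zero    = proj₁ (∧-true e)
  go p f e (suc i) = go p (f ∘ suc) (proj₂ (∧-true {p (f zero)} e)) i

allFin-all : ∀ {n} (p : Fin n → Bool) → (∀ i → p i ≡ true) → all p (allFin n) ≡ true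
allFin-all p = go p id
  where
  go : ∀ {n m} (p : Fin m → Bool) (f : Fin n → Fin m) → (∀ i → p (f i) ≡ true) → all p (List.tabulate f) ≡ true
  go {zero}  p f e = refl
  go {suc n} p f e = true-∧ (e zero) (go p (f ∘ suc) (e ∘ suc))

any-allFin : ∀ {n} (p : Fin n → Bool) → any p (allFin n) ≡ true → ∃ λ i → p i ≡ true
any-allFin p = go p id
  where
  go : ∀ {n m} (p : Fin m → Bool) (f : Fin n → Fin m) → any p (List.tabulate f) ≡ true → ∃ λ i → p i ≡ true
  go {suc n} p f e with ∨-true {p (f zero)} e
  ... | inj₁ e₀ = f zero , e₀
  ... | inj₂ e₁ = go p (f ∘ suc) e₁

allFin-any : ∀ {n} (p : Fin n → Bool) i → p i ≡ true → any p (allFin n) ≡ true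
allFin-any p = go p id
  where
  go : ∀ {n m} (p : Fin m → Bool) (f : Fin n → Fin m) i → p (f i) ≡ true → any p (List.tabulate f) ≡ true
  go p f zero    e = true-∨ (inj₁ e)
  go p f (suc i) e = true-∨ {p (f zero)} (inj₂ (go p (f ∘ suc) i e))

ProperVec : ∀ {n k} → Graph n → Vec (Fin k) n → Set
ProperVec G c = ∀ i j → adj G i j ≡ true → lookup c i ≢ lookup c j

properᵇ⇒Proper : ∀ {n k} (G : Graph n) (c : Vec (Fin k) n) → properᵇ G c ≡ true → ProperVec G c
properᵇ⇒Proper G c e i j a with all-allFin _ (all-allFin _ e i) j
... | e′ rewrite a = notDoes-true (lookup c i ≟ lookup c j) e′

Proper⇒properᵇ : ∀ {n k} (G : Graph n) (c : Vec (Fin k) n) → ProperVec G c → properᵇ G c ≡ true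
Proper⇒properᵇ G c pr = allFin-all _ λ i → allFin-all _ λ j → go i j
  where
  go : ∀ i j → (if adj G i j then not (does (lookup c i ≟ lookup c j)) else true) ≡ true
  go i j with adj G i j in a
  ... | false = refl
  ... | true  = true-notDoes (lookup c i ≟ lookup c j) (pr i j a)

ι : Bool → ℕ
ι true  = 1
ι false = 0

ΣV : ∀ q n → (Vec (Fin q) n → ℕ) → ℕ
ΣV q zero    F = F []
ΣV q (suc n) F = sum (λ x → ΣV q n (λ c → F (x ∷ c)))

ΣV-cong : ∀ {q} n {F G : Vec (Fin q) n → ℕ} → F ≗ G → ΣV q n F ≡ ΣV q n G
ΣV-cong zero    e = e []
ΣV-cong (suc n) e = sum-cong-≗ (λ x → ΣV-cong n (λ c → e (x ∷ c)))

ΣV-+ : ∀ {q} n (F G : Vec (Fin q) n → ℕ) → ΣV q n (λ c → F c + G c) ≡ ΣV q n F + ΣV q n G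
ΣV-+ zero    F G = refl
ΣV-+ (suc n) F G = trans (sum-cong-≗ (λ x → ΣV-+ n (λ c → F (x ∷ c)) (λ c → G (x ∷ c))))
                         (∑-distrib-+ (λ x → ΣV _ n (λ c → F (x ∷ c))) (λ x → ΣV _ n (λ c → G (x ∷ c))))

ΣV-* : ∀ {q} n a (F : Vec (Fin q) n → ℕ) → ΣV q n (λ c → a * F c) ≡ a * ΣV q n F
ΣV-* zero    a F = refl
ΣV-* (suc n) a F = trans (sum-cong-≗ (λ x → ΣV-* n a (λ c → F (x ∷ c))))
                         (sym (*-distribˡ-sum a (λ x → ΣV _ n (λ c → F (x ∷ c)))))

ΣV-0 : ∀ {q} n → ΣV q n (λ _ → 0) ≡ 0
ΣV-0 n = ΣV-* n 0 (λ _ → 0)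

ΣV-sum : ∀ {q} n m (F : Fin m → Vec (Fin q) n → ℕ) → sum (λ x → ΣV q n (F x)) ≡ ΣV q n (λ c → sum (λ x → F x c))
ΣV-sum zero    m F = refl
ΣV-sum (suc n) m F = trans (∑-comm (λ x y → ΣV _ n (λ c → F x (y ∷ c))))
                           (sum-cong-≗ (λ y → ΣV-sum n m (λ x c → F x (y ∷ c))))

-- Fubini: the colour of an arbitrary vertex is summed innermost, so a vertex can be deleted
-- wherever it stands in the order.
ΣV-insertAt : ∀ {q} n (v : Fin (suc n)) (F : Vec (Fin q) (suc n) → ℕ) →
              ΣV q (suc n) F ≡ ΣV q n (λ c → sum (λ x → F (insertAt c v x)))
ΣV-insertAt n       zero    F = ΣV-sum n _ (λ x c → F (x ∷ c))
ΣV-insertAt (suc n) (suc v) F = sum-cong-≗ (λ y → ΣV-insertAt n v (λ c → F (y ∷ c)))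

sum-δ : ∀ {q} (a : Fin q) → sum (λ x → ι (does (x ≟ a))) ≡ 1
sum-δ {suc q} zero    = cong suc (trans (sum-cong-≗ {q} (λ x → refl)) (sum-replicate-zero q))
sum-δ {suc q} (suc a) = trans (sum-cong-≗ (λ x → lemma x)) (sum-δ a)
  where
  lemma : ∀ x → ι (does (suc x ≟ suc a)) ≡ ι (does (x ≟ a))
  lemma x with x ≟ a
  ... | yes _ = refl
  ... | no _  = refl

sum-1 : ∀ q → sum {q} (λ _ → 1) ≡ q
sum-1 zero    = refl
sum-1 (suc q) = cong suc (sum-1 q)

chromatic : ∀ {n} → Graph n → ℕ → ℕ
chromatic {n} G q = ΣV q n (λ c → ι (properᵇ G c))

chromatic-cong : ∀ {n} (G H : Graph n) → (∀ i j → adj G i j ≡ adj H i j) → chromatic G ≗ chromatic H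
chromatic-cong {n} G H e q = ΣV-cong n λ c → cong ι (bool-ext
  (λ p → Proper⇒properᵇ H c λ i j a → properᵇ⇒Proper G c p i j (trans (e i j) a))
  (λ p → Proper⇒properᵇ G c λ i j a → properᵇ⇒Proper H c p i j (trans (sym (e i j)) a)))

ΣV>0 : ∀ {q} n (F : Vec (Fin q) n → ℕ) → 0 < ΣV q n F → ∃ λ c → 0 < F c
ΣV>0 zero    F p = [] , p
ΣV>0 {q} (suc n) F p with go _ p
  where
  go : ∀ {m} (f : Fin m → ℕ) → 0 < sum f → ∃ λ x → 0 < f x
  go {suc m} f p with f zero in e
  ... | suc _ = zero , subst (0 <_) (sym e) (s≤s z≤n)
  ... | zero with go (f ∘ suc) p
  ...   | x , p′ = suc x , p′
... | x , p′ with ΣV>0 n _ p′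
...   | c , p″ = x ∷ c , p″

≤-sum : ∀ {m} (f : Fin m → ℕ) x → f x ≤ sum f
≤-sum f zero    = m≤m+n _ _
≤-sum f (suc x) = ≤-trans (≤-sum (f ∘ suc) x) (m≤n+m _ _)

≤-ΣV : ∀ {q} n (F : Vec (Fin q) n → ℕ) c → F c ≤ ΣV q n F
≤-ΣV zero    F []      = ≤-refl
≤-ΣV (suc n) F (x ∷ c) = ≤-trans (≤-ΣV n (λ c → F (x ∷ c)) c) (≤-sum (λ x → ΣV _ n (λ c → F (x ∷ c))) x)

chromatic>0⇒colouring : ∀ {n q} (G : Graph n) → 0 < chromatic G q → Σ (Fin n → Fin q) (Proper G)
chromatic>0⇒colouring {n} G p with ΣV>0 n _ p
... | c , p′ with properᵇ G c in e
...   | true = lookup c , properᵇ⇒Proper G c e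

colouring⇒chromatic>0 : ∀ {n q} (G : Graph n) → Σ (Fin n → Fin q) (Proper G) → 0 < chromatic G q
colouring⇒chromatic>0 {n} G (f , pr) = ≤-trans (≤-reflexive (cong ι (sym e))) (≤-ΣV n _ (tabulate f))
  where
  e : properᵇ G (tabulate f) ≡ true
  e = Proper⇒properᵇ G (tabulate f) λ i j a →
    subst₂ _≢_ (sym (lookup∘tabulate f i)) (sym (lookup∘tabulate f j)) (pr i j a)

infixl 6 _-ᵥ_

_-ᵥ_ : ∀ {n} → Graph (suc n) → Fin (suc n) → Graph n
G -ᵥ v = record
  { adj    = λ i j → adj G (punchIn v i) (punchIn v j)
  ; sym    = λ i j → Graph.sym G (punchIn v i) (punchIn v j)
  ; irrefl = λ i → irrefl G (punchIn v i)
  }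

data View {n} (v : Fin (suc n)) : Fin (suc n) → Set where
  same  : View v v
  other : ∀ w → View v (punchIn v w)

view : ∀ {n} (v w : Fin (suc n)) → View v w
view v w with v ≟ w
... | yes refl = same
... | no v≢w   = subst (View v) (punchIn-punchOut v≢w) (other (punchOut v≢w))

adj-sym : ∀ {n} (G : Graph n) {i j} → adj G i j ≡ true → adj G j i ≡ true
adj-sym G {i} {j} a = trans (Graph.sym G j i) a

adj-irrefl : ∀ {n} (G : Graph n) {i} → ¬ (adj G i i ≡ true)
adj-irrefl G {i} a with trans (sym (irrefl G i)) a
... | ()

Proper-insertAt : ∀ {n q} (G : Graph (suc n)) v (c : Vec (Fin q) n) x → ProperVec (G -ᵥ v) c →
  (∀ w → adj G v (punchIn v w) ≡ true → x ≢ lookup c w) → ProperVec G (insertAt c v x)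
Proper-insertAt G v c x pr ok i j a with view v i | view v j
... | same    | same    = ⊥-elim (adj-irrefl G a)
... | same    | other w = subst₂ _≢_ (sym (insertAt-lookup c v x)) (sym (insertAt-punchIn c v x w)) (ok w a)
... | other w | same    = subst₂ _≢_ (sym (insertAt-punchIn c v x w)) (sym (insertAt-lookup c v x)) (ok w (adj-sym G a) ∘ sym)
... | other u | other w = subst₂ _≢_ (sym (insertAt-punchIn c v x u)) (sym (insertAt-punchIn c v x w)) (pr u w a)

Proper-delete : ∀ {n q} (G : Graph (suc n)) v (c : Vec (Fin q) n) x → ProperVec G (insertAt c v x) → ProperVec (G -ᵥ v) c
Proper-delete G v c x pr i j a = subst₂ _≢_ (insertAt-punchIn c v x i) (insertAt-punchIn c v x j) (pr _ _ a)

Proper-neighbour : ∀ {n q} (G : Graph (suc n)) v (c : Vec (Fin q) n) x → ProperVec G (insertAt c v x) →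
  ∀ w → adj G v (punchIn v w) ≡ true → x ≢ lookup c w
Proper-neighbour G v c x pr w a = subst₂ _≢_ (insertAt-lookup c v x) (insertAt-punchIn c v x w) (pr _ _ a)

chromatic-isolated : ∀ {n} (G : Graph (suc n)) v → (∀ w → ¬ adj G v w ≡ true) →
                     ∀ q → chromatic G q ≡ q * chromatic (G -ᵥ v) q
chromatic-isolated {n} G v iso q = trans (ΣV-insertAt n v (λ c → ι (properᵇ G c)))
  (trans (ΣV-cong n (λ c → trans (sum-cong-≗ (λ x → cong ι (eq c x))) (const-sum (ι (properᵇ (G -ᵥ v) c))))) (ΣV-* n q _))
  where
  eq : ∀ c x → properᵇ G (insertAt c v x) ≡ properᵇ (G -ᵥ v) c
  eq c x = bool-ext
    (λ p → Proper⇒properᵇ (G -ᵥ v) c (Proper-delete G v c x (properᵇ⇒Proper G (insertAt c v x) p)))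
    (λ p → Proper⇒properᵇ G (insertAt c v x) (Proper-insertAt G v c x (properᵇ⇒Proper (G -ᵥ v) c p) (λ w a → ⊥-elim (iso _ a))))
  const-sum : ∀ a → sum {q} (λ _ → a) ≡ q * a
  const-sum a = trans (sum-cong-≗ {q} (λ _ → sym (*-identityʳ a)))
    (trans (sym (*-distribˡ-sum {q} a (λ _ → 1))) (trans (cong (a *_) (sum-1 q)) (*-comm a q)))

-- One quantity for three situations: it is 0 if `a` and `b` coincide (a leaf), everything if they
-- are adjacent (a simplicial vertex), and for distinct `a`, `b` the count for the graph with the
-- edge `ab` added.
splitCount : ∀ {n q} (G : Graph n) (a b : Fin n) → ℕ
splitCount {n} {q} G a b = ΣV q n (λ c → ι (properᵇ G c) * ι (not (does (lookup c a ≟ lookup c b))))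

-- A vertex with neighbours a and b has q - 1 - [c a ≠ c b] admissible colours.
chromatic-delete : ∀ {n} (G : Graph (suc n)) v (a b : Fin n) →
  adj G v (punchIn v a) ≡ true → adj G v (punchIn v b) ≡ true →
  (∀ w → adj G v (punchIn v w) ≡ true → w ≡ a ⊎ w ≡ b) →
  ∀ q → chromatic G q + chromatic (G -ᵥ v) q + splitCount {q = q} (G -ᵥ v) a b ≡ q * chromatic (G -ᵥ v) q
chromatic-delete {n} G v a b va vb only q = trans
  (cong (λ z → z + chromatic (G -ᵥ v) q + splitCount {q = q} (G -ᵥ v) a b) (ΣV-insertAt n v (λ c → ι (properᵇ G c))))
  (trans (cong (_+ splitCount {q = q} (G -ᵥ v) a b) (sym (ΣV-+ n _ _)))
  (trans (sym (ΣV-+ n _ _)) (trans (ΣV-cong n pointwise) (ΣV-* n q _))))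
  where
  free : Fin q → Fin q → Fin q → Bool
  free s t x = not (does (x ≟ s)) ∧ not (does (x ≟ t))
  -- The factors `1 *` and `* 1` are the value of `ι (properᵇ _ c)` at a proper colouring, kept so
  -- that `count` fits `pointwise`.
  count : ∀ s t → sum (λ x → ι (free s t x)) + 1 + 1 * ι (not (does (s ≟ t))) ≡ q * 1
  count s t = trans (cong (λ z → sum (λ x → ι (free s t x)) + z + 1 * ι (not (does (s ≟ t)))) (sym (sum-δ s)))
    (trans (cong₂ _+_ (sym (∑-distrib-+ (λ x → ι (free s t x)) (λ x → ι (does (x ≟ s))))) second)
    (trans (sym (∑-distrib-+ (λ x → ι (free s t x) + ι (does (x ≟ s))) (λ x → ι (not (does (s ≟ t))) * ι (does (x ≟ t)))))
    (trans (sum-cong-≗ one) (trans (sum-1 q) (sym (*-identityʳ q))))))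
    where
    second : 1 * ι (not (does (s ≟ t))) ≡ sum (λ x → ι (not (does (s ≟ t))) * ι (does (x ≟ t)))
    second = trans (*-comm 1 _) (trans (cong (ι (not (does (s ≟ t))) *_) (sym (sum-δ t)))
      (*-distribˡ-sum (ι (not (does (s ≟ t)))) (λ x → ι (does (x ≟ t)))))
    -- Each colour falls under exactly one heading: free, equal to `s`, or equal to `t` with `t`
    -- different from `s`.
    one : ∀ x → ι (free s t x) + ι (does (x ≟ s)) + ι (not (does (s ≟ t))) * ι (does (x ≟ t)) ≡ 1
    one x with s ≟ t
    one x | yes refl with x ≟ s
    ... | yes _ = refl
    ... | no _  = refl
    one x | no s≢t with x ≟ s | x ≟ t
    ... | yes refl | yes refl = ⊥-elim (s≢t refl)
    ... | yes _    | no _     = refl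
    ... | no _     | yes _    = refl
    ... | no _     | no _     = refl
  pointwise : ∀ c → sum (λ x → ι (properᵇ G (insertAt c v x))) + ι (properᵇ (G -ᵥ v) c)
              + ι (properᵇ (G -ᵥ v) c) * ι (not (does (lookup c a ≟ lookup c b)))
              ≡ q * ι (properᵇ (G -ᵥ v) c)
  pointwise c with properᵇ (G -ᵥ v) c in e
  ... | false = trans (+-identityʳ _) (trans (+-identityʳ _) (trans
        (sum-cong-≗ (λ x → cong ι (none x))) (trans (sum-replicate-zero q) (sym (*-zeroʳ q)))))
    where
    none : ∀ x → properᵇ G (insertAt c v x) ≡ false
    none x = ¬-not λ p → not-¬ e (Proper⇒properᵇ (G -ᵥ v) c (Proper-delete G v c x (properᵇ⇒Proper G (insertAt c v x) p)))
  ... | true = trans (cong (λ z → z + 1 + 1 * ι (not (does (lookup c a ≟ lookup c b)))) (sum-cong-≗ (λ x → cong ι (eq x))))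
                     (count (lookup c a) (lookup c b))
    where
    eq : ∀ x → properᵇ G (insertAt c v x) ≡ free (lookup c a) (lookup c b) x
    eq x = bool-ext
      (λ p → let nb = Proper-neighbour G v c x (properᵇ⇒Proper G (insertAt c v x) p) in
             true-∧ (true-notDoes (x ≟ lookup c a) (nb a va)) (true-notDoes (x ≟ lookup c b) (nb b vb)))
      (λ p → Proper⇒properᵇ G (insertAt c v x) (Proper-insertAt G v c x (properᵇ⇒Proper (G -ᵥ v) c e) λ w adjw →
        [ (λ { refl → notDoes-true (x ≟ lookup c a) (proj₁ (∧-true p)) })
        , (λ { refl → notDoes-true (x ≟ lookup c b) (proj₂ (∧-true {not (does (x ≟ lookup c a))} p)) }) ]′ (only w adjw)))

splitCount-loop : ∀ {n q} (G : Graph n) a → splitCount {q = q} G a a ≡ 0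
splitCount-loop {n} {q} G a = trans (ΣV-cong n (λ c → trans
    (cong (λ z → ι (properᵇ G c) * ι (not z)) (dec-true (lookup c a ≟ lookup c a) refl)) (*-zeroʳ (ι (properᵇ G c)))))
  (ΣV-0 {q} n)

chromatic-leaf : ∀ {n} (G : Graph (suc n)) v (a : Fin n) → adj G v (punchIn v a) ≡ true →
  (∀ w → adj G v (punchIn v w) ≡ true → w ≡ a) → ∀ q → chromatic G q ≡ (q ∸ 1) * chromatic (G -ᵥ v) q
chromatic-leaf G v a va only q = lemma q (trans (sym (trans
    (cong (chromatic G q + chromatic (G -ᵥ v) q +_) (splitCount-loop {q = q} (G -ᵥ v) a)) (+-identityʳ _)))
  (chromatic-delete G v a a va va (λ w e → inj₁ (only w e)) q))
  where
  lemma : ∀ q {x y} → x + y ≡ q * y → x ≡ (q ∸ 1) * y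
  lemma zero    {x} e = m+n≡0⇒m≡0 x e
  lemma (suc q) {x} {y} e = +-cancelʳ-≡ y x (q * y) (trans e (+-comm y (q * y)))

chromatic-simplicial : ∀ {n} (G : Graph (suc n)) v (a b : Fin n) →
  adj G v (punchIn v a) ≡ true → adj G v (punchIn v b) ≡ true →
  (∀ w → adj G v (punchIn v w) ≡ true → w ≡ a ⊎ w ≡ b) → adj (G -ᵥ v) a b ≡ true →
  ∀ q → chromatic G q ≡ (q ∸ 2) * chromatic (G -ᵥ v) q
chromatic-simplicial {n} G v a b va vb only ab q = lemma q (trans
  (cong (chromatic G q + chromatic H q +_) (sym (ΣV-cong {q} n split)))
  (chromatic-delete G v a b va vb only q))
  where
  H = G -ᵥ v
  split : ∀ c → ι (properᵇ H c) * ι (not (does (lookup c a ≟ lookup c b))) ≡ ι (properᵇ H c)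
  split c with properᵇ H c in e
  ... | false = refl
  ... | true  = trans (+-identityʳ _) (cong ι (true-notDoes (lookup c a ≟ lookup c b) (properᵇ⇒Proper H c e _ _ ab)))
  lemma : ∀ q {x y} → x + y + y ≡ q * y → x ≡ (q ∸ 2) * y
  lemma zero {x} {y} e = m+n≡0⇒m≡0 x (m+n≡0⇒m≡0 (x + y) e)
  lemma (suc zero) {x} {y} e = m+n≡0⇒m≡0 x (+-cancelʳ-≡ y (x + y) 0 (trans e (+-identityʳ y)))
  lemma (suc (suc z)) {x} {y} e = +-cancelʳ-≡ y x (z * y) (+-cancelʳ-≡ y (x + y) (z * y + y) (trans e (lemma′ z y)))
    where
    lemma′ : ∀ z y → (2 + z) * y ≡ z * y + y + y
    lemma′ = solve-∀

addEdge : ∀ {n} (G : Graph n) (a b : Fin n) → a ≢ b → Graph n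
addEdge G a b a≢b = record
  { adj    = λ i j → adj G i j ∨ (e i a j b ∨ e i b j a)
  ; sym    = λ i j → cong₂ _∨_ (Graph.sym G i j) (lemma (does (i ≟ a)) (does (j ≟ b)) (does (i ≟ b)) (does (j ≟ a)))
  ; irrefl = λ i → trans (cong (_∨ (e i a i b ∨ e i b i a)) (irrefl G i)) (loop i)
  }
  where
  e : ∀ i a j b → Bool
  e i a j b = does (i ≟ a) ∧ does (j ≟ b)
  lemma : ∀ p q r s → (p ∧ q) ∨ (r ∧ s) ≡ (s ∧ r) ∨ (q ∧ p)
  lemma true  true  true  true  = refl
  lemma true  true  true  false = refl
  lemma true  true  false true  = refl
  lemma true  true  false false = refl
  lemma true  false true  true  = refl
  lemma true  false true  false = refl
  lemma true  false false true  = refl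
  lemma true  false false false = refl
  lemma false true  true  true  = refl
  lemma false true  true  false = refl
  lemma false true  false true  = refl
  lemma false true  false false = refl
  lemma false false true  true  = refl
  lemma false false true  false = refl
  lemma false false false true  = refl
  lemma false false false false = refl
  loop : ∀ i → e i a i b ∨ e i b i a ≡ false
  loop i with i ≟ a | i ≟ b
  ... | yes refl | yes refl = ⊥-elim (a≢b refl)
  ... | yes _    | no _     = refl
  ... | no _     | yes _    = refl
  ... | no _     | no _     = refl

module _ {n} (G : Graph n) {a b : Fin n} (a≢b : a ≢ b) where

  adj-addEdge : ∀ {i j} → adj (addEdge G a b a≢b) i j ≡ true →
                adj G i j ≡ true ⊎ (i ≡ a × j ≡ b) ⊎ (i ≡ b × j ≡ a)
  adj-addEdge {i} {j} p with ∨-true {adj G i j} p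
  ... | inj₁ p = inj₁ p
  ... | inj₂ p with ∨-true {does (i ≟ a) ∧ does (j ≟ b)} p
  ...   | inj₁ p = inj₂ (inj₁ (does-true (i ≟ a) (proj₁ (∧-true p)) , does-true (j ≟ b) (proj₂ (∧-true {does (i ≟ a)} p))))
  ...   | inj₂ p = inj₂ (inj₂ (does-true (i ≟ b) (proj₁ (∧-true p)) , does-true (j ≟ a) (proj₂ (∧-true {does (i ≟ b)} p))))

  addEdge-old : ∀ {i j} → adj G i j ≡ true → adj (addEdge G a b a≢b) i j ≡ true
  addEdge-old p = true-∨ (inj₁ p)

  addEdge-new : adj (addEdge G a b a≢b) a b ≡ true
  addEdge-new = true-∨ {adj G a b} (inj₂ (true-∨ (inj₁ (true-∧ (dec-true (a ≟ a) refl) (dec-true (b ≟ b) refl)))))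

  splitCount-addEdge : ∀ q → splitCount {q = q} G a b ≡ chromatic (addEdge G a b a≢b) q
  splitCount-addEdge q = ΣV-cong n λ c → trans (ι-∧ (properᵇ G c) _) (cong ι (bool-ext
    (λ p → Proper⇒properᵇ (addEdge G a b a≢b) c λ i j ad → go c (properᵇ⇒Proper G c (proj₁ (∧-true p)))
      (notDoes-true (lookup c a ≟ lookup c b) (proj₂ (∧-true {properᵇ G c} p))) i j (adj-addEdge ad))
    (λ p → let pr = properᵇ⇒Proper (addEdge G a b a≢b) c p in true-∧
      (Proper⇒properᵇ G c λ i j ad → pr i j (addEdge-old ad))
      (true-notDoes (lookup c a ≟ lookup c b) (pr a b addEdge-new)))))
    where
    ι-∧ : ∀ x y → ι x * ι y ≡ ι (x ∧ y)
    ι-∧ true  true  = refl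
    ι-∧ true  false = refl
    ι-∧ false _     = refl
    go : ∀ c → ProperVec G c → lookup c a ≢ lookup c b → ∀ i j →
         adj G i j ≡ true ⊎ (i ≡ a × j ≡ b) ⊎ (i ≡ b × j ≡ a) → lookup c i ≢ lookup c j
    go c pr ne i j (inj₁ ad)                  = pr i j ad
    go c pr ne i j (inj₂ (inj₁ (refl , refl))) = ne
    go c pr ne i j (inj₂ (inj₂ (refl , refl))) = ne ∘ sym

-- The first coordinate moves to position `π ⟨$⟩ʳ zero`, where `ΣV-insertAt` can single it out, and
-- `remove zero π` permutes the remaining ones.
ΣV-permute : ∀ {q n m} (π : Permutation n m) (F : Vec (Fin q) n → ℕ) →
             ΣV q n F ≡ ΣV q m (λ c → F (tabulate (λ i → lookup c (π ⟨$⟩ʳ i))))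
ΣV-permute {n = zero}  {zero}  π F = refl
ΣV-permute {n = zero}  {suc m} π F with π ⟨$⟩ˡ zero
... | ()
ΣV-permute {n = suc n} {zero}  π F with π ⟨$⟩ʳ zero
... | ()
ΣV-permute {n = suc n} {suc m} π F = trans
  (sum-cong-≗ (λ x → ΣV-permute (remove zero π) (λ c → F (x ∷ c))))
  (trans (ΣV-sum m _ (λ x c → F (x ∷ tabulate (λ i → lookup c (remove zero π ⟨$⟩ʳ i)))))
  (trans (ΣV-cong m (λ c → sum-cong-≗ (λ x → cong F (cong₂ _∷_
      (sym (insertAt-lookup c (π ⟨$⟩ʳ zero) x))
      (tabulate-cong (λ i → sym (trans (cong (lookup (insertAt c (π ⟨$⟩ʳ zero) x)) (punchIn-permute π zero i))
        (insertAt-punchIn c (π ⟨$⟩ʳ zero) x (remove zero π ⟨$⟩ʳ i)))))))))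
  (sym (ΣV-insertAt m (π ⟨$⟩ʳ zero) (λ c → F (tabulate (λ i → lookup c (π ⟨$⟩ʳ i))))))))

chromatic-≅ : ∀ {n m} (G : Graph n) (H : Graph m) → G ≅ H → chromatic G ≗ chromatic H
chromatic-≅ {n} {m} G H (π , e) q = trans (ΣV-permute π (λ c → ι (properᵇ G c))) (ΣV-cong m λ c → cong ι (bool-ext
  (λ p → Proper⇒properᵇ H c λ i j a → subst₂ _≢_
    (trans (lookup∘tabulate (color c) _) (cong (lookup c) (inverseʳ π)))
    (trans (lookup∘tabulate (color c) _) (cong (lookup c) (inverseʳ π)))
    (properᵇ⇒Proper G (tabulate (color c)) p (π ⟨$⟩ˡ i) (π ⟨$⟩ˡ j)
      (trans (sym (e _ _)) (trans (cong₂ (adj H) (inverseʳ π) (inverseʳ π)) a))))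
  (λ p → Proper⇒properᵇ G (tabulate (color c)) λ i j a →
    subst₂ _≢_ (sym (lookup∘tabulate (color c) i)) (sym (lookup∘tabulate (color c) j))
      (properᵇ⇒Proper H c p _ _ (trans (e i j) a)))))
  where
  color : ∀ {q} → Vec (Fin q) m → Fin n → Fin q
  color c i = lookup c (π ⟨$⟩ʳ i)

-- Decomposition of graphs of maximum degree two

infix 4 _⊢_~_

_⊢_~_ : ∀ {n} → Graph n → Fin n → Fin n → Set
G ⊢ v ~ w = adj G v w ≡ true

AtMostTwoNeighbours : ∀ {n} → Graph n → Set
AtMostTwoNeighbours G = ∀ v {x y z} → G ⊢ v ~ x → G ⊢ v ~ y → G ⊢ v ~ z → x ≡ y ⊎ y ≡ z ⊎ x ≡ z

Isolated : ∀ {n} → Graph n → Fin n → Set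
Isolated G v = ∀ w → ¬ G ⊢ v ~ w

OneNeighbour : ∀ {n} → Graph n → Fin n → Set
OneNeighbour G v = ∃ λ a → G ⊢ v ~ a × (∀ w → G ⊢ v ~ w → w ≡ a)

TwoNeighbours : ∀ {n} → Graph n → Fin n → Set
TwoNeighbours G v = ∃₂ λ a b → a ≢ b × G ⊢ v ~ a × G ⊢ v ~ b × (∀ w → G ⊢ v ~ w → w ≡ a ⊎ w ≡ b)

TwoRegular : ∀ {n} → Graph n → Set
TwoRegular G = ∀ v → TwoNeighbours G v

atMostTwo-delete : ∀ {n} (G : Graph (suc n)) v → AtMostTwoNeighbours G → AtMostTwoNeighbours (G -ᵥ v)
atMostTwo-delete G v le u x y z with le (punchIn v u) x y z
... | inj₁ e        = inj₁ (punchIn-injective v _ _ e)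
... | inj₂ (inj₁ e) = inj₂ (inj₁ (punchIn-injective v _ _ e))
... | inj₂ (inj₂ e) = inj₂ (inj₂ (punchIn-injective v _ _ e))

classify : ∀ {n} (G : Graph n) → AtMostTwoNeighbours G → ∀ v →
           (Isolated G v ⊎ OneNeighbour G v) ⊎ TwoNeighbours G v
classify G le v with any? (λ w → adj G v w Bool.≟ true)
... | no none      = inj₁ (inj₁ λ w a → none (w , a))
... | yes (s , vs) with any? (λ w → ¬? (w ≟ s) ×-dec (adj G v w Bool.≟ true))
...   | no none           = inj₁ (inj₂ (s , vs , only))
  where
  only : ∀ w → G ⊢ v ~ w → w ≡ s
  only w a with w ≟ s
  ... | yes e = e
  ... | no ne = ⊥-elim (none (w , ne , a))
...   | yes (t , t≢s , vt) = inj₂ (s , t , t≢s ∘ sym , vs , vt , only)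
  where
  only : ∀ w → G ⊢ v ~ w → w ≡ s ⊎ w ≡ t
  only w a with le v vs vt a
  ... | inj₁ e        = ⊥-elim (t≢s (sym e))
  ... | inj₂ (inj₁ e) = inj₂ (sym e)
  ... | inj₂ (inj₂ e) = inj₁ (sym e)

search : ∀ {n} {A B : Fin n → Set} → (∀ v → A v ⊎ B v) → ∃ A ⊎ (∀ v → B v)
search {zero}  f = inj₂ λ ()
search {suc n} f with f zero | search (f ∘ suc)
... | inj₁ a | _            = inj₁ (zero , a)
... | inj₂ b | inj₁ (v , a) = inj₁ (suc v , a)
... | inj₂ b | inj₂ g       = inj₂ λ { zero → b ; (suc v) → g v }

twoNeighbours-delete : ∀ {n} (G : Graph (suc n)) v i → TwoNeighbours G (punchIn v i) →
                       ¬ G ⊢ v ~ punchIn v i → TwoNeighbours (G -ᵥ v) i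
twoNeighbours-delete G v i (s , t , s≢t , as , at , only) na with view v s | view v t
... | same    | _       = ⊥-elim (na (adj-sym G as))
... | other s | same    = ⊥-elim (na (adj-sym G at))
... | other s | other t = s , t , s≢t ∘ cong (punchIn v) , as , at , λ w a →
  [ inj₁ ∘ punchIn-injective v _ _ , inj₂ ∘ punchIn-injective v _ _ ]′ (only _ a)

oneNeighbour-delete : ∀ {n} (G : Graph (suc n)) v i → TwoNeighbours G (punchIn v i) →
                      G ⊢ v ~ punchIn v i → OneNeighbour (G -ᵥ v) i
oneNeighbour-delete G v i (s , t , s≢t , as , at , only) va with view v s | view v t
... | same    | same    = ⊥-elim (s≢t refl)
... | same    | other t = t , at , λ w a → [ ⊥-elim ∘ punchInᵢ≢i v w , punchIn-injective v _ _ ]′ (only _ a)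
... | other s | same    = s , as , λ w a → [ punchIn-injective v _ _ , ⊥-elim ∘ punchInᵢ≢i v w ]′ (only _ a)
... | other s | other t with only v (adj-sym G va)
...   | inj₁ e = ⊥-elim (punchInᵢ≢i v s (sym e))
...   | inj₂ e = ⊥-elim (punchInᵢ≢i v t (sym e))

NeighboursIn : ∀ {n} → Graph (suc n) → Fin (suc n) → Fin n → Fin n → Set
NeighboursIn G v a b = G ⊢ v ~ punchIn v a × G ⊢ v ~ punchIn v b × (∀ w → G ⊢ v ~ punchIn v w → w ≡ a ⊎ w ≡ b)

neighboursIn : ∀ {n} (G : Graph (suc n)) v → TwoNeighbours G v → ∃₂ λ a b → a ≢ b × NeighboursIn G v a b
neighboursIn G v (s , t , s≢t , as , at , only) with view v s | view v t
... | same    | _       = ⊥-elim (adj-irrefl G as)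
... | other s | same    = ⊥-elim (adj-irrefl G at)
... | other s | other t = s , t , s≢t ∘ cong (punchIn v) , as , at , λ w a →
  [ inj₁ ∘ punchIn-injective v _ _ , inj₂ ∘ punchIn-injective v _ _ ]′ (only _ a)

-- G is the disjoint union of a cycle through v, of the parity and length given by shape,
-- and of the graph rest.
record CycleThrough {n} (G : Graph (suc n)) (v : Fin (suc n)) : Set where
  field
    shape     : CycleParity
    {order}   : ℕ
    rest      : Graph order
    regular   : TwoRegular rest
    size      : suc n ≡ cycleLength shape + order
    whole     : ∀ q → chromatic G q ≡ cyclePoly shape q * chromatic rest q
    remainder : ∀ q → chromatic (G -ᵥ v) q ≡ q * ((q ∸ 1) ^ (cycleLength shape ∸ 2) * chromatic rest q)

-- The inductive step along a cycle: deleting `v` and joining its neighbours by a new edge shortens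
-- the cycle by one. This requires `a` and `b` to be non-adjacent; if they are adjacent, the cycle
-- is a triangle.
module Suppress {n} (G : Graph (2 + n)) (reg : TwoRegular G) (v : Fin (2 + n)) (a b : Fin (suc n)) (a≢b : a ≢ b)
                (nbrs : NeighboursIn G v a b) where
  H = G -ᵥ v
  va = proj₁ nbrs
  vb = proj₁ (proj₂ nbrs)
  only = proj₂ (proj₂ nbrs)

  end-a : OneNeighbour H a
  end-a = oneNeighbour-delete G v a (reg _) va

  end-b : OneNeighbour H b
  end-b = oneNeighbour-delete G v b (reg _) vb

  inner : ∀ i → i ≢ a → i ≢ b → TwoNeighbours H i
  inner i i≢a i≢b = twoNeighbours-delete G v i (reg _) λ e → [ i≢a , i≢b ]′ (only i e)

  module Shorten (a≁b : ¬ H ⊢ a ~ b) where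
    H⁺ = addEdge H a b a≢b

    regular⁺ : TwoRegular H⁺
    regular⁺ i = go (i ≟ a) (i ≟ b)
      where
      go : Dec (i ≡ a) → Dec (i ≡ b) → TwoNeighbours H⁺ i
      go (yes refl) _ with end-a
      ... | c , ac , onlyc = c , b , (λ { refl → a≁b ac }) , addEdge-old H a≢b ac , addEdge-new H a≢b , λ w e →
            [ inj₁ ∘ onlyc w , [ inj₂ ∘ proj₂ , (λ p → ⊥-elim (a≢b (proj₁ p))) ]′ ]′ (adj-addEdge H a≢b e)
      go (no _) (yes refl) with end-b
      ... | c , bc , onlyc = c , a , (λ { refl → a≁b (adj-sym H bc) }) , addEdge-old H a≢b bc , adj-sym H⁺ (addEdge-new H a≢b) , λ w e →
            [ inj₁ ∘ onlyc w , [ (λ p → ⊥-elim (a≢b (sym (proj₁ p)))) , inj₂ ∘ proj₂ ]′ ]′ (adj-addEdge H a≢b e)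
      go (no i≢a) (no i≢b) with inner i i≢a i≢b
      ... | s , t , s≢t , is , it , onlyst = s , t , s≢t , addEdge-old H a≢b is , addEdge-old H a≢b it , λ w e →
            [ onlyst w , [ ⊥-elim ∘ i≢a ∘ proj₁ , ⊥-elim ∘ i≢b ∘ proj₁ ]′ ]′ (adj-addEdge H a≢b e)

    -- In `H` the vertex `a` is a leaf, and the edge added in `H⁺` disappears together with `a`.
    -- Hence the `remainder` of the cycle through `a` in `H⁺` determines `chromatic H`; this is why
    -- that field is carried along and why the recursion continues at `a`.
    delete-a : ∀ q → chromatic H q ≡ (q ∸ 1) * chromatic (H⁺ -ᵥ a) q
    delete-a q with end-a
    ... | c , ac , onlyc with view a c
    ...   | same    = ⊥-elim (adj-irrefl H ac)
    ...   | other c = trans (chromatic-leaf H a c ac (λ w e → punchIn-injective a _ _ (onlyc _ e)) q)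
                            (cong ((q ∸ 1) *_) (chromatic-cong (H -ᵥ a) (H⁺ -ᵥ a) (λ i j → bool-ext
                              (addEdge-old H a≢b)
                              (λ e → [ id , [ ⊥-elim ∘ punchInᵢ≢i a i ∘ proj₁ , ⊥-elim ∘ punchInᵢ≢i a j ∘ proj₂ ]′ ]′ (adj-addEdge H a≢b e))) q))

    lengthen : CycleThrough H⁺ a → CycleThrough G v
    lengthen cyc = record
      { shape     = grow C.shape
      ; rest      = C.rest
      ; regular   = C.regular
      ; size      = trans (cong suc C.size) (cong (_+ C.order) (sym (cycleLength-grow C.shape)))
      ; whole     = λ q → whole q
      ; remainder = rem
      }
      where
      module C = CycleThrough cyc
      L = cycleLength C.shape
      length≥2 : ∀ l → suc (cycleLength l ∸ 2) ≡ cycleLength (grow l) ∸ 2 × cycleLength l ≡ suc (cycleLength (grow l) ∸ 2)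
      length≥2 (odd k)  = refl , refl
      length≥2 (even k) = refl , refl
      rem : ∀ q → chromatic H q ≡ q * ((q ∸ 1) ^ (cycleLength (grow C.shape) ∸ 2) * chromatic C.rest q)
      rem q = trans (delete-a q) (trans (cong ((q ∸ 1) *_) (C.remainder q))
        (trans (lemma (q ∸ 1) q ((q ∸ 1) ^ (L ∸ 2)) (chromatic C.rest q))
               (cong (λ e → q * ((q ∸ 1) ^ e * chromatic C.rest q)) (proj₁ (length≥2 C.shape)))))
        where
        lemma : ∀ y q p r → y * (q * (p * r)) ≡ q * (y * p * r)
        lemma = solve-∀
      count : ∀ q → chromatic G q + chromatic H q + cyclePoly C.shape q * chromatic C.rest q ≡ q * chromatic H q
      count q = trans (cong (chromatic G q + chromatic H q +_) (sym (trans (splitCount-addEdge H a≢b q) (C.whole q))))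
                      (chromatic-delete G v a b va vb only q)
      whole : ∀ q → chromatic G q ≡ cyclePoly (grow C.shape) q * chromatic C.rest q
      whole zero = trans (m+n≡0⇒m≡0 (chromatic G 0) (m+n≡0⇒m≡0 (chromatic G 0 + chromatic H 0) (count 0))) (sym (lemma C.shape))
        where
        lemma : ∀ l → cyclePoly (grow l) 0 * chromatic C.rest 0 ≡ 0
        lemma (odd k)  = refl
        lemma (even k) = refl
      -- Cancelling `h` in the deletion formula shows that `G` and `H⁺` together have `y * h`
      -- colourings; `rem` turns this into the right side of `cyclePoly-grow`, times `r`.
      whole (suc y) = +-cancelʳ-≡ (cyclePoly C.shape (suc y) * r) _ _ (+-cancelˡ-≡ h _ _
        (trans (lemma₁ h (chromatic G (suc y)) (cyclePoly C.shape (suc y) * r))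
        (trans (count (suc y)) (trans (cong (λ z → h + y * z) (rem (suc y)))
        (cong (h +_) (trans (lemma₂ y (suc y) (y ^ (cycleLength (grow C.shape) ∸ 2)) r)
        (trans (cong (λ e → suc y * y ^ e * r) (sym (proj₂ (length≥2 C.shape))))
        (trans (cong (_* r) (sym (cyclePoly-grow C.shape y))) (*-distribʳ-+ r (cyclePoly (grow C.shape) (suc y)) _)))))))))
        where
        h = chromatic H (suc y)
        r = chromatic C.rest (suc y)
        lemma₁ : ∀ h g c → h + (g + c) ≡ g + h + c
        lemma₁ = solve-∀
        lemma₂ : ∀ y q p r → y * (q * (p * r)) ≡ q * (y * p) * r
        lemma₂ = solve-∀

-- Here `v` is simplicial; once it is gone `a` is a leaf attached to `b`, and after `a` the vertex
-- `b` is isolated. The three deletions give the factors `q - 2`, `q - 1` and `q`.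
triangleThrough : ∀ {n} (G : Graph (3 + n)) → TwoRegular G → ∀ v (a : Fin (2 + n)) (b : Fin (suc n)) →
  NeighboursIn G v a (punchIn a b) → (G -ᵥ v) ⊢ a ~ punchIn a b → CycleThrough G v
triangleThrough {n} G reg v a b nbrs ab = record
  { shape     = odd 0
  ; rest      = K
  ; regular   = regular
  ; size      = refl
  ; whole     = whole
  ; remainder = rem
  }
  where
  open Suppress G reg v a (punchIn a b) (punchInᵢ≢i a b ∘ sym) nbrs
  K = H -ᵥ a -ᵥ b
  only-b : ∀ w → H ⊢ a ~ w → w ≡ punchIn a b
  only-b w e = trans (proj₂ (proj₂ end-a) w e) (sym (proj₂ (proj₂ end-a) _ ab))
  only-a : ∀ w → H ⊢ punchIn a b ~ w → w ≡ a
  only-a w e = trans (proj₂ (proj₂ end-b) w e) (sym (proj₂ (proj₂ end-b) _ (adj-sym H ab)))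
  b-isolated : Isolated (H -ᵥ a) b
  b-isolated w e = punchInᵢ≢i a w (only-a _ e)
  regular : TwoRegular K
  regular i = twoNeighbours-delete (H -ᵥ a) b i
    (twoNeighbours-delete H a (punchIn b i)
      (inner _ (punchInᵢ≢i a _) (punchInᵢ≢i b i ∘ punchIn-injective a _ _))
      (λ e → punchInᵢ≢i b i (punchIn-injective a _ _ (only-b _ e))))
    (b-isolated _)
  leaf-a : ∀ q → chromatic H q ≡ (q ∸ 1) * (q * chromatic K q)
  leaf-a q = trans (chromatic-leaf H a b ab (λ w e → punchIn-injective a _ _ (only-b _ e)) q)
                   (cong ((q ∸ 1) *_) (chromatic-isolated (H -ᵥ a) b b-isolated q))
  rem : ∀ q → chromatic H q ≡ q * ((q ∸ 1) ^ 1 * chromatic K q)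
  rem q = trans (leaf-a q) (lemma (q ∸ 1) q (chromatic K q))
    where
    lemma : ∀ y q r → y * (q * r) ≡ q * (y * 1 * r)
    lemma = solve-∀
  whole : ∀ q → chromatic G q ≡ cyclePoly (odd 0) q * chromatic K q
  whole zero          = chromatic-simplicial G v a (punchIn a b) va vb only ab 0
  whole (suc zero)    = chromatic-simplicial G v a (punchIn a b) va vb only ab 1
  whole (suc (suc z)) = trans (chromatic-simplicial G v a (punchIn a b) va vb only ab (2 + z))
    (trans (cong (z *_) (leaf-a (2 + z))) (lemma z (chromatic K (2 + z))))
    where
    lemma : ∀ z r → z * ((1 + z) * ((2 + z) * r)) ≡ (2 + z) * ((1 + z) * (z * 1)) * 1 * r
    lemma = solve-∀

cycleThrough : ∀ n (G : Graph (suc n)) → TwoRegular G → ∀ v → CycleThrough G v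
cycleThrough zero G reg v with neighboursIn G v (reg v)
... | () , _
cycleThrough (suc n) G reg v with neighboursIn G v (reg v)
... | a , b , a≢b , nbrs with adj (G -ᵥ v) a b in e
...   | false = lengthen (cycleThrough n H⁺ regular⁺ a)
  where open Suppress.Shorten G reg v a b a≢b nbrs (not-¬ e)
...   | true = close n G reg v a b a≢b nbrs e
  where
  close : ∀ n (G : Graph (2 + n)) → TwoRegular G → ∀ v (a b : Fin (suc n)) → a ≢ b →
          NeighboursIn G v a b → (G -ᵥ v) ⊢ a ~ b → CycleThrough G v
  close n G reg v a b a≢b nbrs ab with view a b
  close n       G reg v a _ a≢b nbrs ab | same    = ⊥-elim (a≢b refl)
  close (suc n) G reg v a _ a≢b nbrs ab | other b = triangleThrough G reg v a b nbrs ab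

-- Vertices with at most one neighbour are removed first; what is left is a union of cycles.
atMostTwo-induction : (Q : ∀ {n} → Graph n → Set) →
  (∀ (G : Graph 0) → Q G) →
  (∀ {n} (G : Graph (suc n)) v → Isolated G v → Q (G -ᵥ v) → Q G) →
  (∀ {n} (G : Graph (suc n)) v → OneNeighbour G v → Q (G -ᵥ v) → Q G) →
  (∀ {n} (G : Graph (suc n)) (C : CycleThrough G zero) → TwoRegular G → Q (CycleThrough.rest C) → Q G) →
  ∀ {n} (G : Graph n) → AtMostTwoNeighbours G → Q G
atMostTwo-induction Q empty isolated leaf cycle {n} G le = go n n ≤-refl G le
  where
  twoRegular⇒atMostTwo : ∀ {n} (G : Graph n) → TwoRegular G → AtMostTwoNeighbours G
  twoRegular⇒atMostTwo G reg v vx vy vz with reg v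
  ... | a , b , _ , _ , _ , only with only _ vx | only _ vy | only _ vz
  ...   | inj₁ refl | inj₁ refl | _         = inj₁ refl
  ...   | inj₂ refl | inj₂ refl | _         = inj₁ refl
  ...   | inj₁ refl | inj₂ refl | inj₁ refl = inj₂ (inj₂ refl)
  ...   | inj₁ refl | inj₂ refl | inj₂ refl = inj₂ (inj₁ refl)
  ...   | inj₂ refl | inj₁ refl | inj₁ refl = inj₂ (inj₁ refl)
  ...   | inj₂ refl | inj₁ refl | inj₂ refl = inj₂ (inj₂ refl)
  -- Removing a cycle lowers the order by several vertices at once, so the recursion runs on a bound
  -- `N` for the order.
  go : ∀ N n → n ≤ N → (G : Graph n) → AtMostTwoNeighbours G → Q G
  go N       zero    _         G le = empty G
  go (suc N) (suc n) (s≤s n≤N) G le with search (classify G le)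
  ... | inj₁ (v , inj₁ iso) = isolated G v iso (go N n n≤N (G -ᵥ v) (atMostTwo-delete G v le))
  ... | inj₁ (v , inj₂ one) = leaf G v one (go N n n≤N (G -ᵥ v) (atMostTwo-delete G v le))
  ... | inj₂ reg = cycle G C reg (go N order (≤-trans small n≤N) rest (twoRegular⇒atMostTwo rest regular))
    where
    C = cycleThrough n G reg zero
    open CycleThrough C
    small : order ≤ n
    small = ≤-pred (≤-trans (s≤s (m≤n+m order _)) (≤-reflexive (trans (cong (λ l → l + order) (lemma shape)) (sym size))))
      where
      lemma : ∀ l → suc (cycleLength l ∸ 1) ≡ cycleLength l
      lemma (odd k)  = refl
      lemma (even k) = refl

-- Inductive comparison with edgeless graphs, K₂ and K₃

HasEdge : ∀ {n} → Graph n → Set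
HasEdge G = ∃₂ λ v w → G ⊢ v ~ w

HasCherry : ∀ {n} → Graph n → Set
HasCherry G = ∃ λ v → ∃₂ λ x y → x ≢ y × G ⊢ v ~ x × G ⊢ v ~ y

-- Restricting one endpoint of each edge suffices, since adjacency is symmetric; the record
-- therefore describes K₃ with isolated vertices.
record OnlyTriangle {n} (G : Graph n) : Set where
  field
    {a b c} : Fin n
    a≢b : a ≢ b
    b≢c : b ≢ c
    a≢c : a ≢ c
    ab  : G ⊢ a ~ b
    bc  : G ⊢ b ~ c
    ac  : G ⊢ a ~ c
    all-edges : ∀ {i j} → G ⊢ i ~ j → i ≡ a ⊎ i ≡ b ⊎ i ≡ c

-- The indices count differently: `trianglePoly m` belongs to K₃ ∪ mK₁, but `edgePoly (suc p)` to K₂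
-- ∪ pK₁, because one endpoint of the edge contributes a factor `q` to the power.
edgePoly trianglePoly : ℕ → ℕ → ℕ
edgePoly m     = (λ q → q ∸ 1) ⊗ pow m
trianglePoly m = (λ q → fall q 3) ⊗ pow m

-- All comparisons are proved together: splitting K₂ or K₃ off one component leaves the other
-- components to `⊒empty` and `⊐empty`. Positivity at 3 and 4 lets a strict inequality survive
-- multiplication. The cherry excludes K₂ ∪ pK₁ itself, for which `⊐edge` would fail.
record Bounds {n} (G : Graph n) : Set where
  field
    positive₃ : 0 < chromatic G 3
    positive₄ : 0 < chromatic G 4
    ⊒empty    : chromatic G ⊒ pow n
    ⊐empty    : HasEdge G → chromatic G ⊐ pow n
    ⊒edge     : HasCherry G → 0 < chromatic G 2 → chromatic G ⊒ edgePoly (n ∸ 1)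
    ⊐edge     : HasCherry G → 0 < chromatic G 2 → chromatic G ⊐ edgePoly (n ∸ 1)
    triangle  : chromatic G 2 ≡ 0 → ∃ λ m → n ≡ 3 + m × chromatic G ⊒ trianglePoly m ×
                (chromatic G ⊐ trianglePoly m ⊎ OnlyTriangle G)

⊐-⊗ʳ : ∀ {P P′ Q Q′} → P ⊒ Q → 0 < P 4 → 0 < Q 3 → P′ ⊐ Q′ → (P ⊗ P′) ⊐ (Q ⊗ Q′)
⊐-⊗ʳ {P} {P′} {Q} {Q′} l p q s = ⊐-cong (λ x → *-comm (P′ x) (P x)) (λ x → *-comm (Q′ x) (Q x)) (⊐-⊗ s l p q)

*-swap : ∀ a b c → a * (b * c) ≡ b * (a * c)
*-swap = solve-∀

>0⇒≢0 : ∀ {n} → 0 < n → n ≢ 0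
>0⇒≢0 p refl = <-irrefl refl p

factor≡0 : ∀ {m n} → 0 < m → m * n ≡ 0 → n ≡ 0
factor≡0 {m} p e with m*n≡0⇒m≡0∨n≡0 m e
... | inj₁ e = ⊥-elim (>0⇒≢0 p e)
... | inj₂ e = e

factor>0 : ∀ a {b} → 0 < a * b → 0 < b
factor>0 a {zero}  p = ⊥-elim (>0⇒≢0 p (*-zeroʳ a))
factor>0 a {suc b} p = s≤s z≤n

trianglePoly>0 : ∀ m → 0 < trianglePoly m 3
trianglePoly>0 m = *-mono-≤ {1} {6} (s≤s z≤n) (m^n>0 3 m)

bounds-empty : (G : Graph 0) → Bounds G
bounds-empty G = record
  { positive₃ = s≤s z≤n
  ; positive₄ = s≤s z≤n
  ; ⊒empty    = ⊒-cong (λ q → refl) (λ q → refl) (⊒-refl {λ _ → 1})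
  ; ⊐empty    = λ { (() , _) }
  ; ⊒edge     = λ { (() , _) }
  ; ⊐edge     = λ { (() , _) }
  ; triangle  = λ ()
  }

module _ {n} (G : Graph (suc n)) (v : Fin (suc n)) where

  bounds-isolated : Isolated G v → Bounds (G -ᵥ v) → Bounds G
  bounds-isolated iso B = record
    { positive₃ = subst (0 <_) (eq 3) (*-mono-≤ {1} {3} (s≤s z≤n) B.positive₃)
    ; positive₄ = subst (0 <_) (eq 4) (*-mono-≤ {1} {4} (s≤s z≤n) B.positive₄)
    ; ⊒empty    = ⊒-cong eq (λ _ → refl) (⊒-⊗ (⊒-refl {λ q → q}) B.⊒empty)
    ; ⊐empty    = λ e → ⊐-cong eq (λ _ → refl) (⊐-⊗ʳ (⊒-refl {λ q → q}) (s≤s z≤n) (s≤s z≤n) (B.⊐empty (edge e)))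
    ; ⊒edge     = λ e p → ⊒-cong eq (shift (vertex (cherry e))) (⊒-⊗ (⊒-refl {λ q → q}) (B.⊒edge (cherry e) (positive p)))
    ; ⊐edge     = λ e p → ⊐-cong eq (shift (vertex (cherry e)))
        (⊐-⊗ʳ (⊒-refl {λ q → q}) (s≤s z≤n) (s≤s z≤n) (B.⊐edge (cherry e) (positive p)))
    ; triangle  = tri
    }
    where
    module B = Bounds B
    eq : ((λ q → q) ⊗ chromatic (G -ᵥ v)) ≗ chromatic G
    eq q = sym (chromatic-isolated G v iso q)
    positive : 0 < chromatic G 2 → 0 < chromatic (G -ᵥ v) 2
    positive p = factor>0 2 (subst (0 <_) (sym (eq 2)) p)
    edge : HasEdge G → HasEdge (G -ᵥ v)
    edge (x , y , xy) with view v x | view v y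
    ... | same    | _       = ⊥-elim (iso y xy)
    ... | other _ | same    = ⊥-elim (iso _ (adj-sym G xy))
    ... | other x | other y = x , y , xy
    cherry : HasCherry G → HasCherry (G -ᵥ v)
    cherry (w , x , y , x≢y , wx , wy) with view v w | view v x | view v y
    ... | same    | _       | _       = ⊥-elim (iso _ wx)
    ... | other _ | same    | _       = ⊥-elim (iso _ (adj-sym G wx))
    ... | other _ | other _ | same    = ⊥-elim (iso _ (adj-sym G wy))
    ... | other w | other x | other y = w , x , y , x≢y ∘ cong (punchIn v) , wx , wy
    vertex : HasCherry (G -ᵥ v) → Fin n
    vertex = proj₁
    -- The vertex excludes `n = 0`, where the truncated `n ∸ 1` would give the wrong exponent.
    shift : ∀ {n} → Fin n → ((λ q → q) ⊗ edgePoly (n ∸ 1)) ≗ edgePoly n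
    shift {suc n} _ q = *-swap q (q ∸ 1) (q ^ n)
    onlyTriangle : OnlyTriangle (G -ᵥ v) → OnlyTriangle G
    onlyTriangle T = record
      { a≢b = T.a≢b ∘ punchIn-injective v _ _
      ; b≢c = T.b≢c ∘ punchIn-injective v _ _
      ; a≢c = T.a≢c ∘ punchIn-injective v _ _
      ; ab = T.ab ; bc = T.bc ; ac = T.ac
      ; all-edges = all-edges
      }
      where
      module T = OnlyTriangle T
      all-edges : ∀ {i j} → G ⊢ i ~ j → i ≡ punchIn v T.a ⊎ i ≡ punchIn v T.b ⊎ i ≡ punchIn v T.c
      all-edges {i} {j} ij with view v i | view v j
      ... | same    | _       = ⊥-elim (iso _ ij)
      ... | other _ | same    = ⊥-elim (iso _ (adj-sym G ij))
      ... | other i | other j = [ inj₁ ∘ cong (punchIn v) , inj₂ ∘ [ inj₁ ∘ cong (punchIn v) , inj₂ ∘ cong (punchIn v) ]′ ]′ (T.all-edges ij)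
    tri : chromatic G 2 ≡ 0 → ∃ λ m → suc n ≡ 3 + m × chromatic G ⊒ trianglePoly m × (chromatic G ⊐ trianglePoly m ⊎ OnlyTriangle G)
    tri e with B.triangle (factor≡0 {2} (s≤s z≤n) (trans (eq 2) e))
    ... | m , size , weak , strict = suc m , cong suc size
        , ⊒-cong eq (λ q → *-swap q (fall q 3) (q ^ m)) (⊒-⊗ (⊒-refl {λ q → q}) weak)
        , [ inj₁ ∘ ⊐-cong eq (λ q → *-swap q (fall q 3) (q ^ m)) ∘ ⊐-⊗ʳ (⊒-refl {λ q → q}) (s≤s z≤n) (s≤s z≤n)
          , inj₂ ∘ onlyTriangle ]′ strict

  -- The leaf contributes a factor `q - 1`. Against `pow` and `trianglePoly` it faces a factor `q`,
  -- which is strict at once. Against `edgePoly` it is itself the split-off edge, so strictness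
  -- comes from another edge, which the cherry leaves in `G -ᵥ v`.
  bounds-leaf : OneNeighbour G v → Bounds (G -ᵥ v) → Bounds G
  bounds-leaf (u , vu , only) B = record
    { positive₃ = subst (0 <_) (eq 3) (*-mono-≤ {1} {2} (s≤s z≤n) B.positive₃)
    ; positive₄ = subst (0 <_) (eq 4) (*-mono-≤ {1} {3} (s≤s z≤n) B.positive₄)
    ; ⊒empty    = ⊒-cong eq (λ _ → refl) (⊒-⊗ (∸⊒id 1) B.⊒empty)
    ; ⊐empty    = λ _ → ⊐-cong eq (λ _ → refl) (⊐-⊗ pred⊐id B.⊒empty B.positive₄ (m^n>0 3 n))
    ; ⊒edge     = λ _ _ → ⊒-cong eq (λ _ → refl) (⊒-⊗ (⊒-refl {λ q → q ∸ 1}) B.⊒empty)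
    ; ⊐edge     = λ c _ → ⊐-cong eq (λ _ → refl) (⊐-⊗ʳ (⊒-refl {λ q → q ∸ 1}) (s≤s z≤n) (s≤s z≤n) (B.⊐empty (edge c)))
    ; triangle  = tri
    }
    where
    module B = Bounds B
    eq : ((λ q → q ∸ 1) ⊗ chromatic (G -ᵥ v)) ≗ chromatic G
    eq with view v u
    ... | same    = ⊥-elim (adj-irrefl G vu)
    ... | other u = λ q → sym (chromatic-leaf G v u vu (λ w e → punchIn-injective v _ _ (only _ e)) q)
    edge : HasCherry G → HasEdge (G -ᵥ v)
    edge (w , x , y , x≢y , wx , wy) with view v w | view v x | view v y
    ... | same    | _       | _       = ⊥-elim (x≢y (trans (only _ wx) (sym (only _ wy))))
    ... | other w | other x | _       = w , x , wx
    ... | other w | same    | other y = w , y , wy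
    ... | other _ | same    | same    = ⊥-elim (x≢y refl)
    tri : chromatic G 2 ≡ 0 → ∃ λ m → suc n ≡ 3 + m × chromatic G ⊒ trianglePoly m × (chromatic G ⊐ trianglePoly m ⊎ OnlyTriangle G)
    tri e with B.triangle (factor≡0 {1} (s≤s z≤n) (trans (eq 2) e))
    ... | m , size , weak , _ = suc m , cong suc size
        , ⊒-cong eq (λ q → *-swap q (fall q 3) (q ^ m)) (⊒-⊗ (∸⊒id 1) weak)
        , inj₁ (⊐-cong eq (λ q → *-swap q (fall q 3) (q ^ m)) (⊐-⊗ pred⊐id weak B.positive₄ (trianglePoly>0 m)))

twoRegular₃ : (G : Graph 3) → TwoRegular G → ∀ i j → i ≢ j → G ⊢ i ~ j
twoRegular₃ G reg i j i≢j with view i j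
... | same    = ⊥-elim (i≢j refl)
... | other k with neighboursIn G i (reg i)
...   | s , t , s≢t , is , it , _ = go s t k s≢t is it
  where
  go : ∀ (s t k : Fin 2) → s ≢ t → G ⊢ i ~ punchIn i s → G ⊢ i ~ punchIn i t → G ⊢ i ~ punchIn i k
  go zero       t          zero       ne is it = is
  go (suc zero) t          (suc zero) ne is it = is
  go s          zero       zero       ne is it = it
  go s          (suc zero) (suc zero) ne is it = it
  go zero       zero       (suc zero) ne is it = ⊥-elim (ne refl)
  go (suc zero) (suc zero) zero       ne is it = ⊥-elim (ne refl)

onlyTriangle₃ : (G : Graph 3) → TwoRegular G → OnlyTriangle G
onlyTriangle₃ G reg = record
  { a = zero ; b = suc zero ; c = suc (suc zero)
  ; a≢b = λ () ; b≢c = λ () ; a≢c = λ ()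
  ; ab = twoRegular₃ G reg _ _ λ () ; bc = twoRegular₃ G reg _ _ λ () ; ac = twoRegular₃ G reg _ _ λ ()
  ; all-edges = λ {i} _ → cover i
  }
  where
  cover : ∀ (i : Fin 3) → i ≡ zero ⊎ i ≡ suc zero ⊎ i ≡ suc (suc zero)
  cover zero             = inj₁ refl
  cover (suc zero)       = inj₂ (inj₁ refl)
  cover (suc (suc zero)) = inj₂ (inj₂ refl)

pow-size : ∀ {n} a b → n ≡ a + b → (pow a ⊗ pow b) ≗ pow n
pow-size a b refl = pow-+ a b

-- An even cycle supplies K₂ through its factor `q - 1`, an odd cycle K₃ through `fall q 3`;
-- cofactor and rest are compared with powers. If the cycle is even and `G` has no 2-colouring, the
-- triangle is split off from the rest.
bounds-cycle : ∀ {n} (G : Graph (suc n)) (C : CycleThrough G zero) → TwoRegular G →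
               Bounds (CycleThrough.rest C) → Bounds G
bounds-cycle {n} G C reg B = record
  { positive₃ = subst (0 <_) (eq 3) (*-mono-≤ (cyclePoly>0 shape 0) B.positive₃)
  ; positive₄ = subst (0 <_) (eq 4) (*-mono-≤ (cyclePoly>0 shape 1) B.positive₄)
  ; ⊒empty    = ⊒-cong eq (pow-size (cycleLength shape) order size) (⊒-⊗ (cycle⊒ shape) B.⊒empty)
  ; ⊐empty    = λ _ → ⊐-cong eq (pow-size (cycleLength shape) order size)
                  (⊐-⊗ (cycle⊐ shape) B.⊒empty B.positive₄ (m^n>0 3 order))
  ; ⊒edge     = λ _ → proj₁ ∘ edge shape size eq
  ; ⊐edge     = λ _ → proj₂ ∘ edge shape size eq
  ; triangle  = tri shape size eq
  }
  where
  open CycleThrough C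
  module B = Bounds B
  eq : (cyclePoly shape ⊗ chromatic rest) ≗ chromatic G
  eq q = sym (whole q)

  edge : ∀ l → suc n ≡ cycleLength l + order → (cyclePoly l ⊗ chromatic rest) ≗ chromatic G → 0 < chromatic G 2 →
         chromatic G ⊒ edgePoly n × chromatic G ⊐ edgePoly n
  edge (odd k)  size eq p = ⊥-elim (>0⇒≢0 p (sym (eq 2)))
  edge (even k) size eq p = ⊒-cong eq eq′ (⊒-⊗ (⊒-⊗ (⊒-refl {λ q → q ∸ 1}) (evenFactor⊒ k)) B.⊒empty)
    , ⊐-cong eq eq′ (⊐-⊗ (⊐-⊗ʳ (⊒-refl {λ q → q ∸ 1}) (s≤s z≤n) (s≤s z≤n) (evenFactor⊐ k)) B.⊒empty B.positive₄ (m^n>0 3 order))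
    where
    eq′ : (((λ q → q ∸ 1) ⊗ pow (3 + double k)) ⊗ pow order) ≗ edgePoly n
    eq′ q = trans (*-assoc (q ∸ 1) _ _) (cong ((q ∸ 1) *_) (pow-size (3 + double k) order (suc-injective size) q))

  tri : ∀ l → suc n ≡ cycleLength l + order → (cyclePoly l ⊗ chromatic rest) ≗ chromatic G → chromatic G 2 ≡ 0 →
        ∃ λ m → suc n ≡ 3 + m × chromatic G ⊒ trianglePoly m × (chromatic G ⊐ trianglePoly m ⊎ OnlyTriangle G)
  tri (odd k) size eq e = double k + order , size
    , ⊒-cong eq eq′ (⊒-⊗ (⊒-⊗ (⊒-refl {λ q → fall q 3}) (oddFactor⊒ k)) B.⊒empty) , strict k order rest regular B size eq
    where
    eq″ : ∀ k o → (((λ q → fall q 3) ⊗ pow (double k)) ⊗ pow o) ≗ trianglePoly (double k + o)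
    eq″ k o q = trans (*-assoc (fall q 3) _ _) (cong (fall q 3 *_) (pow-+ (double k) o q))
    eq′ = eq″ k order
    -- A longer odd cycle is strict through its cofactor. A triangle relies on an edge of the rest,
    -- which two-regularity provides unless the rest is empty; that is the case of equality.
    strict : ∀ k o (K : Graph o) → TwoRegular K → Bounds K → suc n ≡ 3 + double k + o →
             (cyclePoly (odd k) ⊗ chromatic K) ≗ chromatic G →
             chromatic G ⊐ trianglePoly (double k + o) ⊎ OnlyTriangle G
    strict (suc k) o K regK BK _ eq = inj₁ (⊐-cong eq (eq″ (suc k) o)
      (⊐-⊗ (⊐-⊗ʳ (⊒-refl {λ q → fall q 3}) (s≤s z≤n) (s≤s z≤n) (oddFactor⊐ k)) (Bounds.⊒empty BK) (Bounds.positive₄ BK) (m^n>0 3 o)))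
    strict zero zero K regK BK refl eq = inj₂ (onlyTriangle₃ G reg)
    strict zero (suc o) K regK BK _ eq = inj₁ (⊐-cong eq (eq″ 0 (suc o))
      (⊐-⊗ʳ (⊒-⊗ (⊒-refl {λ q → fall q 3}) (oddFactor⊒ 0)) (s≤s z≤n) (s≤s z≤n)
        (Bounds.⊐empty BK (zero , proj₁ (regK zero) , proj₁ (proj₂ (proj₂ (proj₂ (regK zero))))))))
  tri (even k) size eq e with B.triangle (factor≡0 {cyclePoly (even k) 2} (*-mono-≤ {1} {1} (s≤s z≤n) (evenFactor>0 k 0)) (trans (eq 2) e))
  ... | m , size′ , weak , _ = suc (double k + 3 + m) , trans size (trans (cong (cycleLength (even k) +_) size′) (lemma (double k) m))
      , ⊒-cong eq eq′ (⊒-⊗ (cycle⊒ (even k)) weak)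
      , inj₁ (⊐-cong eq eq′ (⊐-⊗ (cycle⊐ (even k)) weak B.positive₄ (trianglePoly>0 m)))
      where
      lemma : ∀ d m → 4 + d + (3 + m) ≡ 3 + suc (d + 3 + m)
      lemma = solve-∀
      eq′ : (pow (cycleLength (even k)) ⊗ trianglePoly m) ≗ trianglePoly (suc (double k + 3 + m))
      eq′ q = trans (*-swap (q ^ cycleLength (even k)) (fall q 3) (q ^ m))
        (cong (fall q 3 *_) (pow-size (cycleLength (even k)) m (lemma′ (double k) m) q))
        where
        lemma′ : ∀ d m → suc (d + 3 + m) ≡ 4 + d + m
        lemma′ = solve-∀

bounds : ∀ {n} (G : Graph n) → AtMostTwoNeighbours G → Bounds G
bounds = atMostTwo-induction Bounds bounds-empty bounds-isolated bounds-leaf bounds-cycle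

-- From colourings to partitions

T⇒true : ∀ {b} → T b → b ≡ true
T⇒true {true} _ = refl

true⇒T : ∀ {b} → b ≡ true → T b
true⇒T refl = _

sumList : ∀ {A : Set} → (A → ℕ) → List A → ℕ
sumList f []       = 0
sumList f (x ∷ xs) = f x + sumList f xs

length-filter : ∀ {A : Set} (p : A → Bool) xs → length (filter (λ x → p x Bool.≟ true) xs) ≡ sumList (ι ∘ p) xs
length-filter p [] = refl
length-filter p (x ∷ xs) with p x
... | true  = cong suc (length-filter p xs)
... | false = length-filter p xs

sumList-++ : ∀ {A : Set} (f : A → ℕ) xs ys → sumList f (xs ++ ys) ≡ sumList f xs + sumList f ys
sumList-++ f []       ys = refl
sumList-++ f (x ∷ xs) ys = trans (cong (f x +_) (sumList-++ f xs ys)) (sym (+-assoc (f x) _ _))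

sumList-concatMap : ∀ {A B : Set} (f : B → ℕ) (g : A → List B) xs → sumList f (concatMap g xs) ≡ sumList (sumList f ∘ g) xs
sumList-concatMap f g []       = refl
sumList-concatMap f g (x ∷ xs) = trans (sumList-++ f (g x) (concatMap g xs)) (cong (sumList f (g x) +_) (sumList-concatMap f g xs))

sumList-cong : ∀ {A : Set} {f g : A → ℕ} → f ≗ g → ∀ xs → sumList f xs ≡ sumList g xs
sumList-cong e []       = refl
sumList-cong e (x ∷ xs) = cong₂ _+_ (e x) (sumList-cong e xs)

sumList-allFin : ∀ {A : Set} n (f : A → ℕ) (g : Fin n → A) → sumList f (List.map g (allFin n)) ≡ sum (f ∘ g)
sumList-allFin n f g = go n id
  where
  go : ∀ m (h : Fin m → Fin n) → sumList f (List.map g (List.tabulate h)) ≡ sum (f ∘ g ∘ h)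
  go zero    h = refl
  go (suc m) h = cong (f (g (h zero)) +_) (go m (h ∘ suc))

sumList-allVecs : ∀ n q (F : Vec (Fin q) n → ℕ) → sumList F (allVecs n q) ≡ ΣV q n F
sumList-allVecs zero    q F = +-identityʳ (F [])
sumList-allVecs (suc n) q F = trans (sumList-concatMap F (λ v → List.map (λ x → x ∷ v) (allFin q)) (allVecs n q))
  (trans (sumList-cong (λ v → sumList-allFin q F (λ x → x ∷ v)) (allVecs n q))
  (trans (sumList-allVecs n q (λ v → sum (λ x → F (x ∷ v)))) (sym (ΣV-insertAt n zero F))))

-- Restricted growth: the colours below k have been used already, and the next new colour is k.
restrictedGrowth : ∀ {j m} → ℕ → Vec (Fin j) m → Bool
growthStep : ∀ {j m} → ℕ → ℕ → Vec (Fin j) m → Bool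
restrictedGrowth {j} k []      = k ≡ᵇ j
restrictedGrowth     k (x ∷ c) = growthStep k (toℕ x) c
growthStep k x c = if x <ᵇ k then restrictedGrowth k c else (if x ≡ᵇ k then restrictedGrowth (suc k) c else false)

data Growth (k x : ℕ) : Set where
  old : x < k → Growth k x
  new : x ≡ k → Growth k x
  gap : k < x → Growth k x

growth : ∀ k x → Growth k x
growth k x with <-cmp x k
... | tri< lt _ _ = old lt
... | tri≈ _ e _  = new e
... | tri> _ _ gt = gap gt

growthStep-old : ∀ {j m k x} {c : Vec (Fin j) m} → x < k → growthStep k x c ≡ restrictedGrowth k c
growthStep-old lt rewrite T⇒true (<⇒<ᵇ lt) = refl

growthStep-new : ∀ {j m} k {c : Vec (Fin j) m} → growthStep k k c ≡ restrictedGrowth (suc k) c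
growthStep-new k with k <ᵇ k in e
... | true  = ⊥-elim (<-irrefl refl (<ᵇ⇒< k k (true⇒T e)))
... | false rewrite T⇒true (≡⇒≡ᵇ k k refl) = refl

growthStep-gap : ∀ {j m k x} {c : Vec (Fin j) m} → k < x → growthStep k x c ≡ false
growthStep-gap {k = k} {x} lt with x <ᵇ k in e
... | true  = ⊥-elim (<-asym lt (<ᵇ⇒< x k (true⇒T e)))
... | false with x ≡ᵇ k in e′
...   | true  = ⊥-elim (<-irrefl (sym (≡ᵇ⇒≡ x k (true⇒T e′))) lt)
...   | false = refl

-- `SurjectiveFrom` and `CanonicalFrom` are the two tests for a suffix whose prefix has used exactly
-- the colours below `k`. The bound in `CanonicalFrom` is `≤ k` because the predecessor of the next
-- new colour `k` lies in the prefix; at `k = 0` it is the test for colour 0.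
SurjectiveFrom : ∀ {j m} → ℕ → Vec (Fin j) m → Set
SurjectiveFrom {j} k c = ∀ (y : Fin j) → k ≤ toℕ y → ∃ λ i → lookup c i ≡ y

CanonicalFrom : ∀ {j m} → ℕ → Vec (Fin j) m → Set
CanonicalFrom k c = ∀ i → toℕ (lookup c i) ≤ k ⊎ ∃ λ i′ → toℕ i′ < toℕ i × suc (toℕ (lookup c i′)) ≡ toℕ (lookup c i)

restrictedGrowth-sound : ∀ {j m} k (c : Vec (Fin j) m) → restrictedGrowth k c ≡ true → SurjectiveFrom k c × CanonicalFrom k c
restrictedGrowth-sound {j} k [] e = (λ y le → ⊥-elim (<-irrefl (≡ᵇ⇒≡ k j (true⇒T e)) (≤-<-trans le (toℕ<n y)))) , λ ()
restrictedGrowth-sound k (x ∷ c) e with growth k (toℕ x)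
... | gap lt with trans (sym (growthStep-gap {c = c} lt)) e
...   | ()
restrictedGrowth-sound k (x ∷ c) e | old lt with restrictedGrowth-sound k c (trans (sym (growthStep-old {c = c} lt)) e)
... | surj , canon = (λ y le → let (i , p) = surj y le in suc i , p) , canon′
  where
  canon′ : CanonicalFrom k (x ∷ c)
  canon′ zero    = inj₁ (<⇒≤ lt)
  canon′ (suc i) = [ inj₁ , (λ (i′ , lt , e) → inj₂ (suc i′ , s≤s lt , e)) ]′ (canon i)
restrictedGrowth-sound .(toℕ x) (x ∷ c) e | new refl with restrictedGrowth-sound (suc (toℕ x)) c (trans (sym (growthStep-new (toℕ x) {c})) e)
... | surj , canon = surj′ , canon′
  where
  surj′ : SurjectiveFrom (toℕ x) (x ∷ c)
  surj′ y le with m≤n⇒m<n∨m≡n le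
  ... | inj₁ lt = let (i , p) = surj y lt in suc i , p
  ... | inj₂ e  = zero , toℕ-injective e
  canon′ : CanonicalFrom (toℕ x) (x ∷ c)
  canon′ zero    = inj₁ ≤-refl
  canon′ (suc i) with canon i
  ... | inj₂ (i′ , lt , e) = inj₂ (suc i′ , s≤s lt , e)
  ... | inj₁ le with m≤n⇒m<n∨m≡n le
  ...   | inj₁ lt = inj₁ (≤-pred lt)
  ...   | inj₂ e  = inj₂ (zero , s≤s z≤n , sym e)

restrictedGrowth-complete : ∀ {j m} k (c : Vec (Fin j) m) → k ≤ j → SurjectiveFrom k c → CanonicalFrom k c → restrictedGrowth k c ≡ true
restrictedGrowth-complete {j} k [] k≤j surj canon with m≤n⇒m<n∨m≡n k≤j
... | inj₂ refl = T⇒true (≡⇒≡ᵇ k k refl)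
... | inj₁ k<j with surj (fromℕ< k<j) (≤-reflexive (sym (toℕ-fromℕ< k<j)))
...   | () , _
restrictedGrowth-complete k (x ∷ c) k≤j surj canon with growth k (toℕ x)
... | gap lt with canon zero
...   | inj₁ le = ⊥-elim (<-irrefl refl (<-≤-trans lt le))
...   | inj₂ (_ , () , _)
restrictedGrowth-complete k (x ∷ c) k≤j surj canon | old lt =
  trans (growthStep-old {c = c} lt) (restrictedGrowth-complete k c k≤j surj′ canon′)
  where
  surj′ : SurjectiveFrom k c
  surj′ y le with surj y le
  ... | zero  , refl = ⊥-elim (<-irrefl refl (<-≤-trans lt le))
  ... | suc i , p    = i , p
  canon′ : CanonicalFrom k c
  canon′ i with canon (suc i)
  ... | inj₁ le                      = inj₁ le
  ... | inj₂ (zero , _ , e)          = inj₁ (subst (_≤ k) e lt)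
  ... | inj₂ (suc i′ , s≤s lt′ , e)  = inj₂ (i′ , lt′ , e)
restrictedGrowth-complete .(toℕ x) (x ∷ c) k≤j surj canon | new refl =
  trans (growthStep-new (toℕ x) {c}) (restrictedGrowth-complete (suc (toℕ x)) c (toℕ<n x) surj′ canon′)
  where
  surj′ : SurjectiveFrom (suc (toℕ x)) c
  surj′ y le with surj y (<⇒≤ le)
  ... | zero  , refl = ⊥-elim (<-irrefl refl le)
  ... | suc i , p    = i , p
  canon′ : CanonicalFrom (suc (toℕ x)) c
  canon′ i with canon (suc i)
  ... | inj₁ le                      = inj₁ (m≤n⇒m≤1+n le)
  ... | inj₂ (zero , _ , e)          = inj₁ (≤-reflexive (sym e))
  ... | inj₂ (suc i′ , s≤s lt′ , e)  = inj₂ (i′ , lt′ , e)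

surjᵇ∧canonicalᵇ : ∀ {n j} (c : Vec (Fin j) n) → surjᵇ c ∧ canonicalᵇ c ≡ restrictedGrowth 0 c
surjᵇ∧canonicalᵇ {n} {j} c = bool-ext
  (λ e → restrictedGrowth-complete 0 c z≤n
    (λ y _ → let (i , p) = any-allFin _ (all-allFin _ (proj₁ (∧-true e)) y) in i , does-true (lookup c i ≟ y) p)
    (λ i → canon i (∨-true {toℕ (lookup c i) ≡ᵇ 0} (all-allFin _ (proj₂ (∧-true {surjᵇ c} e)) i))))
  (λ e → let (surj , can) = restrictedGrowth-sound 0 c e in true-∧
    (allFin-all _ λ y → let (i , p) = surj y z≤n in allFin-any (λ i → does (lookup c i ≟ y)) i (dec-true (lookup c i ≟ y) p))
    (allFin-all _ λ i → true-∨ {toℕ (lookup c i) ≡ᵇ 0} (canon′ i (can i))))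
  where
  earlier : Fin n → Fin n → Bool
  earlier i i′ = (toℕ i′ <ᵇ toℕ i) ∧ (suc (toℕ (lookup c i′)) ≡ᵇ toℕ (lookup c i))
  canon : ∀ i → (toℕ (lookup c i) ≡ᵇ 0) ≡ true ⊎ any (earlier i) (allFin n) ≡ true →
          toℕ (lookup c i) ≤ 0 ⊎ ∃ λ i′ → toℕ i′ < toℕ i × suc (toℕ (lookup c i′)) ≡ toℕ (lookup c i)
  canon i (inj₁ e) = inj₁ (≤-reflexive (≡ᵇ⇒≡ _ 0 (true⇒T e)))
  canon i (inj₂ e) with any-allFin (earlier i) e
  ... | i′ , p = inj₂ (i′ , <ᵇ⇒< _ _ (true⇒T (proj₁ (∧-true p))) , ≡ᵇ⇒≡ _ _ (true⇒T (proj₂ (∧-true {toℕ i′ <ᵇ toℕ i} p))))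
  canon′ : ∀ i → toℕ (lookup c i) ≤ 0 ⊎ (∃ λ i′ → toℕ i′ < toℕ i × suc (toℕ (lookup c i′)) ≡ toℕ (lookup c i)) →
           (toℕ (lookup c i) ≡ᵇ 0) ≡ true ⊎ any (earlier i) (allFin n) ≡ true
  canon′ i (inj₁ le)            = inj₁ (T⇒true (≡⇒≡ᵇ _ 0 (n≤0⇒n≡0 le)))
  canon′ i (inj₂ (i′ , lt , e)) = inj₂ (allFin-any (earlier i) i′ (true-∧ (T⇒true (<⇒<ᵇ lt)) (T⇒true (≡⇒≡ᵇ _ _ e))))

-- partitions m k d F sums F over the restricted growth words of length m that start with
-- k colours in use and end with k + d.
partitions : ∀ m → ℕ → ℕ → (Vec ℕ m → ℕ) → ℕ
partitions zero    k zero    F = F []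
partitions zero    k (suc d) F = 0
partitions (suc m) k zero    F = sum {k} (λ x → partitions m k zero (λ c → F (toℕ x ∷ c)))
partitions (suc m) k (suc d) F = sum {k} (λ x → partitions m k (suc d) (λ c → F (toℕ x ∷ c)))
                               + partitions m (suc k) d (λ c → F (k ∷ c))

sum-split : ∀ k e (f : ℕ → ℕ) → sum {k + e} (f ∘ toℕ) ≡ sum {k} (f ∘ toℕ) + sum {e} (λ y → f (k + toℕ y))
sum-split zero    e f = refl
sum-split (suc k) e f = trans (cong (f 0 +_) (sum-split k e (f ∘ suc))) (sym (+-assoc (f 0) _ _))

partitions-restrictedGrowth : ∀ m {j} k d → j ≡ k + d → (F : Vec ℕ m → ℕ) →
  ΣV j m (λ c → ι (restrictedGrowth k c) * F (map toℕ c)) ≡ partitions m k d F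
partitions-restrictedGrowth zero k zero e F rewrite T⇒true (≡⇒≡ᵇ k _ (sym (trans e (+-identityʳ k)))) = +-identityʳ (F [])
partitions-restrictedGrowth zero {j} k (suc d) e F with k ≡ᵇ j in e′
... | false = refl
... | true  = ⊥-elim (m≢1+m+n k (trans (≡ᵇ⇒≡ k j (true⇒T e′)) (trans e (+-suc k d))))
partitions-restrictedGrowth (suc m) k d refl F = trans (sum-split k d body) (split d refl)
  where
  body : ℕ → ℕ
  body x = ΣV (k + d) m (λ c → ι (growthStep k x c) * F (x ∷ map toℕ c))
  olds : sum {k} (body ∘ toℕ) ≡ sum {k} (λ x → partitions m k d (λ c → F (toℕ x ∷ c)))
  olds = sum-cong-≗ {k} λ x → trans
    (ΣV-cong m (λ c → cong (λ b → ι b * F (toℕ x ∷ map toℕ c)) (growthStep-old {c = c} (toℕ<n x))))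
    (partitions-restrictedGrowth m k d refl (λ c → F (toℕ x ∷ c)))
  split : ∀ d′ → d ≡ d′ → sum {k} (body ∘ toℕ) + sum {d′} (λ y → body (k + toℕ y)) ≡ partitions (suc m) k d′ F
  split zero     refl = trans (+-identityʳ _) olds
  split (suc d′) refl = cong₂ _+_ olds (trans (cong₂ _+_ new-one (trans (sum-cong-≗ {d′} gaps) (sum-replicate-zero d′))) (+-identityʳ _))
    where
    new-one : body (k + 0) ≡ partitions m (suc k) d′ (λ c → F (k ∷ c))
    new-one = trans (cong body (+-identityʳ k)) (trans
      (ΣV-cong m (λ c → cong (λ b → ι b * F (k ∷ map toℕ c)) (growthStep-new k {c})))
      (partitions-restrictedGrowth m (suc k) d′ (+-suc k d′) (λ c → F (k ∷ c))))
    gaps : ∀ (y : Fin d′) → body (k + suc (toℕ y)) ≡ 0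
    gaps y = trans (ΣV-cong m (λ c → cong (λ b → ι b * F (k + suc (toℕ y) ∷ map toℕ c))
      (growthStep-gap {c = c} (m<m+n k (s≤s z≤n))))) (ΣV-0 m)

-- Colour symmetry and the falling factorial expansion

swap : ℕ → ℕ → ℕ → ℕ
swap a b x = if x ≡ᵇ a then b else (if x ≡ᵇ b then a else x)

≡ᵇ-refl : ∀ a → (a ≡ᵇ a) ≡ true
≡ᵇ-refl a = T⇒true (≡⇒≡ᵇ a a refl)

≢⇒≡ᵇ-false : ∀ {a b} → a ≢ b → (a ≡ᵇ b) ≡ false
≢⇒≡ᵇ-false {a} {b} a≢b = ¬-not λ e → a≢b (≡ᵇ⇒≡ a b (true⇒T e))

swap-left : ∀ a b → swap a b a ≡ b
swap-left a b rewrite ≡ᵇ-refl a = refl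

swap-other : ∀ {a b x} → x ≢ a → x ≢ b → swap a b x ≡ x
swap-other x≢a x≢b rewrite ≢⇒≡ᵇ-false x≢a | ≢⇒≡ᵇ-false x≢b = refl

swap-right : ∀ a b → swap a b b ≡ a
swap-right a b with b ≡ᵇ a in e
... | true  = ≡ᵇ⇒≡ b a (true⇒T e)
... | false rewrite ≡ᵇ-refl b = refl

swap-involutive : ∀ a b x → swap a b (swap a b x) ≡ x
swap-involutive a b x = go (x ℕ.≟ a) (x ℕ.≟ b)
  where
  go : Dec (x ≡ a) → Dec (x ≡ b) → swap a b (swap a b x) ≡ x
  go (yes refl) _          = trans (cong (swap a b) (swap-left a b)) (swap-right a b)
  go (no _)     (yes refl) = trans (cong (swap a b) (swap-right a b)) (swap-left a b)
  go (no ≢a)    (no ≢b)    = trans (cong (swap a b) (swap-other ≢a ≢b)) (swap-other ≢a ≢b)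

swap-transpose : ∀ {q} (a b x : Fin q) → swap (toℕ a) (toℕ b) (toℕ x) ≡ toℕ (transpose a b ⟨$⟩ʳ x)
swap-transpose a b x with x ≟ a
... | yes refl = swap-left (toℕ a) (toℕ b)
... | no x≢a with x ≟ b
...   | yes refl = swap-right (toℕ a) (toℕ b)
...   | no x≢b   = swap-other (x≢a ∘ toℕ-injective) (x≢b ∘ toℕ-injective)

ΣV-recolour : ∀ {q} m (π : Permutation q q) (F : Vec (Fin q) m → ℕ) → ΣV q m F ≡ ΣV q m (λ c → F (map (π ⟨$⟩ʳ_) c))
ΣV-recolour zero    π F = refl
ΣV-recolour {q} (suc m) π F = trans (sum-permute (λ x → ΣV q m (λ c → F (x ∷ c))) π)
  (sum-cong-≗ (λ x → ΣV-recolour m π (λ c → F ((π ⟨$⟩ʳ x) ∷ c))))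

-- Invariance is asked only for colours not yet used, so that it survives fixing the first colour:
-- an old one keeps the level `k`, the new colour `k` raises it to `suc k`.
SymmetricFrom : ∀ {m} → ℕ → (Vec ℕ m → ℕ) → Set
SymmetricFrom k F = ∀ a b → k ≤ a → k ≤ b → ∀ c → F (map (swap a b) c) ≡ F c

symmetric-old : ∀ {m k} (F : Vec ℕ (suc m) → ℕ) x → x < k → SymmetricFrom k F → SymmetricFrom k (λ c → F (x ∷ c))
symmetric-old F x x<k s a b k≤a k≤b c = trans
  (cong (λ y → F (y ∷ map (swap a b) c)) (sym (swap-other (<⇒≢ (<-≤-trans x<k k≤a)) (<⇒≢ (<-≤-trans x<k k≤b)))))
  (s a b k≤a k≤b (x ∷ c))

symmetric-weaken : ∀ {m k} {F : Vec ℕ m → ℕ} → SymmetricFrom k F → SymmetricFrom (suc k) F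
symmetric-weaken s a b k<a k<b = s a b (<⇒≤ k<a) (<⇒≤ k<b)

colourSum : ∀ q m → (Vec ℕ m → ℕ) → ℕ
colourSum q m F = ΣV q m (λ c → F (map toℕ c))

colourSum-exchange : ∀ {q m k} (F : Vec ℕ (suc m) → ℕ) → SymmetricFrom k F → (a b : Fin q) → k ≤ toℕ a → k ≤ toℕ b →
  colourSum q m (λ c → F (toℕ a ∷ c)) ≡ colourSum q m (λ c → F (toℕ b ∷ c))
colourSum-exchange {q} {m} F s a b k≤a k≤b = trans (ΣV-cong m pointwise) (sym (ΣV-recolour m (transpose a b) (λ c → F (toℕ b ∷ map toℕ c))))
  where
  pointwise : ∀ c → F (toℕ a ∷ map toℕ c) ≡ F (toℕ b ∷ map toℕ (map (transpose a b ⟨$⟩ʳ_) c))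
  pointwise c = trans (sym (s (toℕ a) (toℕ b) k≤a k≤b (toℕ a ∷ map toℕ c)))
    (cong F (cong₂ _∷_ (swap-left (toℕ a) (toℕ b))
      (trans (sym (map-∘ (swap (toℕ a) (toℕ b)) toℕ c))
      (trans (map-cong (swap-transpose a b) c) (map-∘ toℕ (transpose a b ⟨$⟩ʳ_) c)))))

sumTo-front : ∀ N f → sumTo (suc N) f ≡ f 1 + sumTo N (f ∘ suc)
sumTo-front zero    f = sym (+-identityʳ (f 1))
sumTo-front (suc N) f = trans (cong (_+ f (2 + N)) (sumTo-front N f)) (+-assoc (f 1) _ _)

sum-sumTo : ∀ {k} N (f : Fin k → ℕ → ℕ) → sum (λ x → sumTo N (f x)) ≡ sumTo N (λ d → sum (λ x → f x d))
sum-sumTo {k} zero    f = sum-replicate-zero k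
sum-sumTo     (suc N) f = trans (∑-distrib-+ (λ x → sumTo N (f x)) (λ x → f x (suc N))) (cong (_+ sum (λ x → f x (suc N))) (sum-sumTo N f))

sumTo-0 : ∀ N f → (∀ d → f (suc d) ≡ 0) → sumTo N f ≡ 0
sumTo-0 zero    f e = refl
sumTo-0 (suc N) f e = cong₂ _+_ (sumTo-0 N f e) (e N)

sumFrom0 : ℕ → (ℕ → ℕ) → ℕ
sumFrom0 N f = f 0 + sumTo N f

sum-const : ∀ e {c} (f : Fin e → ℕ) → (∀ y → f y ≡ c) → sum f ≡ e * c
sum-const zero    f h = refl
sum-const (suc e) f h = cong₂ _+_ (h zero) (sum-const e (f ∘ suc) (h ∘ suc))

colourSum-partitions : ∀ m {q} k e N → q ≡ k + e → m ≤ N → (F : Vec ℕ m → ℕ) → SymmetricFrom k F →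
  colourSum q m F ≡ sumFrom0 N (λ d → fall e d * partitions m k d F)
colourSum-partitions zero k e N eq m≤N F s = sym (trans
  (cong₂ _+_ (+-identityʳ (F [])) (sumTo-0 N (λ d → fall e d * partitions 0 k d F) (λ d → *-zeroʳ (fall e (suc d)))))
  (+-identityʳ (F [])))
colourSum-partitions (suc m) {q} k e (suc N) refl (s≤s m≤N) F s = trans (sum-split k e body) (trans (cong₂ _+_ olds (news e refl)) combine)
  where
  body : ℕ → ℕ
  body x = colourSum (k + e) m (λ c → F (x ∷ c))
  oldTerm newTerm : ℕ → ℕ
  oldTerm d = sum {k} (λ x → partitions m k d (λ c → F (toℕ x ∷ c)))
  newTerm d = partitions m (suc k) d (λ c → F (k ∷ c))
  olds : sum {k} (body ∘ toℕ) ≡ sumFrom0 (suc N) (λ d → fall e d * oldTerm d)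
  olds = trans (sum-cong-≗ {k} (λ x → colourSum-partitions m k e (suc N) refl (m≤n⇒m≤1+n m≤N) (λ c → F (toℕ x ∷ c)) (symmetric-old F (toℕ x) (toℕ<n x) s)))
    (trans (∑-distrib-+ (λ x → p x 0) (λ x → sumTo (suc N) (p x)))
    (cong₂ _+_ (pull 0) (trans (sum-sumTo (suc N) p) (sumTo-cong (suc N) pull))))
    where
    p : Fin k → ℕ → ℕ
    p x d = fall e d * partitions m k d (λ c → F (toℕ x ∷ c))
    pull : ∀ d → sum (λ x → p x d) ≡ fall e d * oldTerm d
    pull d = sym (*-distribˡ-sum {k} (fall e d) (λ x → partitions m k d (λ c → F (toℕ x ∷ c))))
  news : ∀ e′ → e ≡ e′ → sum {e′} (λ y → body (k + toℕ y)) ≡ sumTo (suc N) (λ d → fall e′ d * newTerm (d ∸ 1))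
  news zero     refl = sym (sumTo-0 (suc N) (λ d → fall 0 d * newTerm (d ∸ 1)) (λ d → refl))
  news (suc e′) refl = trans (sum-const (suc e′) _ exchange) (trans (cong (suc e′ *_) fresh)
    (trans (*-distribˡ-+ (suc e′) (1 * newTerm 0) (sumTo N (λ d → fall e′ d * newTerm d)))
    (trans (cong₂ _+_ (sym (*-assoc (suc e′) 1 (newTerm 0)))
      (trans (sumTo-* N (suc e′) (λ d → fall e′ d * newTerm d)) (sumTo-cong N (λ d → sym (*-assoc (suc e′) (fall e′ d) (newTerm d))))))
    (sym (sumTo-front N (λ d → fall (suc e′) d * newTerm (d ∸ 1)))))))
    where
    fresh : body k ≡ sumFrom0 N (λ d → fall e′ d * newTerm d)
    fresh = colourSum-partitions m (suc k) e′ N (+-suc k e′) m≤N (λ c → F (k ∷ c))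
      (symmetric-old F k ≤-refl (symmetric-weaken s))
    exchange : ∀ y → body (k + toℕ y) ≡ body k
    exchange y = subst₂ (λ u v → body u ≡ body v) (toℕ-fromℕ< ky<) (toℕ-fromℕ< k<)
      (colourSum-exchange F s (fromℕ< ky<) (fromℕ< k<)
        (≤-trans (m≤m+n k (toℕ y)) (≤-reflexive (sym (toℕ-fromℕ< ky<)))) (≤-reflexive (sym (toℕ-fromℕ< k<))))
      where
      ky< : k + toℕ y < k + suc e′
      ky< = +-monoʳ-< k (toℕ<n y)
      k< : k < k + suc e′
      k< = m<m+n k (s≤s z≤n)
  combine : sumFrom0 (suc N) (λ d → fall e d * oldTerm d) + sumTo (suc N) (λ d → fall e d * newTerm (d ∸ 1))
            ≡ sumFrom0 (suc N) (λ d → fall e d * partitions (suc m) k d F)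
  combine = trans (+-assoc (1 * oldTerm 0) _ _) (cong (1 * oldTerm 0 +_)
    (trans (sym (sumTo-+ (suc N) (λ d → fall e d * oldTerm d) (λ d → fall e d * newTerm (d ∸ 1)))) (shifted (suc N))))
    where
    shifted : ∀ M → sumTo M (λ d → fall e d * oldTerm d + fall e d * newTerm (d ∸ 1)) ≡ sumTo M (λ d → fall e d * partitions (suc m) k d F)
    shifted zero    = refl
    shifted (suc M) = cong₂ _+_ (shifted M) (sym (*-distribˡ-+ (fall e (suc M)) (oldTerm (suc M)) (newTerm M)))

-- Properness depends only on which colours coincide; on words over ℕ a single function serves every
-- number of colours, as `partitions` requires.
properℕ : ∀ {n} → Graph n → Vec ℕ n → Bool
properℕ {n} G c = all (λ i → all (λ j →
  if adj G i j then not (does (lookup c i ℕ.≟ lookup c j)) else true) (allFin n)) (allFin n)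

all-cong : ∀ {A : Set} {p p′ : A → Bool} → p ≗ p′ → ∀ xs → all p xs ≡ all p′ xs
all-cong e []       = refl
all-cong e (x ∷ xs) = cong₂ _∧_ (e x) (all-cong e xs)

does-≟ : ∀ {a b c d : ℕ} → (a ≡ b → c ≡ d) → (c ≡ d → a ≡ b) → does (a ℕ.≟ b) ≡ does (c ℕ.≟ d)
does-≟ {a} {b} {c} {d} f g = bool-ext (λ e → dec-true (c ℕ.≟ d) (f (does-true (a ℕ.≟ b) e))) (λ e → dec-true (a ℕ.≟ b) (g (does-true (c ℕ.≟ d) e)))

properᵇ-ℕ : ∀ {n q} (G : Graph n) (c : Vec (Fin q) n) → properᵇ G c ≡ properℕ G (map toℕ c)
properᵇ-ℕ {n} G c = all-cong (λ i → all-cong (λ j → cong (λ b → if adj G i j then not b else true) (eq i j)) (allFin n)) (allFin n)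
  where
  eq : ∀ i j → does (lookup c i ≟ lookup c j) ≡ does (lookup (map toℕ c) i ℕ.≟ lookup (map toℕ c) j)
  eq i j rewrite lookup-map i toℕ c | lookup-map j toℕ c = bool-ext
    (λ e → dec-true (_ ℕ.≟ _) (cong toℕ (does-true (lookup c i ≟ lookup c j) e)))
    (λ e → dec-true (_ ≟ _) (toℕ-injective (does-true (toℕ (lookup c i) ℕ.≟ toℕ (lookup c j)) e)))

properℕ-symmetric : ∀ {n} (G : Graph n) → SymmetricFrom 0 (ι ∘ properℕ G)
properℕ-symmetric {n} G a b _ _ c = cong ι (all-cong (λ i → all-cong (λ j → cong (λ b → if adj G i j then not b else true) (eq i j)) (allFin n)) (allFin n))
  where
  eq : ∀ i j → does (lookup (map (swap a b) c) i ℕ.≟ lookup (map (swap a b) c) j) ≡ does (lookup c i ℕ.≟ lookup c j)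
  eq i j rewrite lookup-map i (swap a b) c | lookup-map j (swap a b) c = does-≟
    {swap a b (lookup c i)} {swap a b (lookup c j)} {lookup c i} {lookup c j}
    (λ e → trans (sym (swap-involutive a b _)) (trans (cong (swap a b) e) (swap-involutive a b _)))
    (cong (swap a b))

S-partitions : ∀ {n} (G : Graph n) k → S G k ≡ partitions n 0 k (ι ∘ properℕ G)
S-partitions {n} G k = trans (length-filter (λ c → properᵇ G c ∧ surjᵇ c ∧ canonicalᵇ c) (allVecs n k))
  (trans (sumList-allVecs n k _) (trans (ΣV-cong n pointwise) (partitions-restrictedGrowth n 0 k refl (ι ∘ properℕ G))))
  where
  ι-∧ : ∀ a b → ι (a ∧ b) ≡ ι b * ι a
  ι-∧ true  true  = refl
  ι-∧ true  false = refl
  ι-∧ false true  = refl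
  ι-∧ false false = refl
  pointwise : ∀ c → ι (properᵇ G c ∧ surjᵇ c ∧ canonicalᵇ c) ≡ ι (restrictedGrowth 0 c) * ι (properℕ G (map toℕ c))
  pointwise c = trans (cong ι (cong₂ _∧_ (properᵇ-ℕ G c) (surjᵇ∧canonicalᵇ c))) (ι-∧ (properℕ G (map toℕ c)) _)

chromatic-fallSum : ∀ {n} (G : Graph (suc n)) → chromatic G ≗ fallSum (suc n) (S G)
chromatic-fallSum {n} G q = trans (ΣV-cong {q} (suc n) (λ c → cong ι (properᵇ-ℕ G c)))
  (trans (colourSum-partitions (suc n) 0 q (suc n) refl ≤-refl (ι ∘ properℕ G) (properℕ-symmetric G))
  -- The summand `d = 0` of `sumFrom0` computes to 0: a nonempty word with no colour in use must
  -- open a new one. This is where the order `suc n` matters.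
  (sumTo-cong (suc n) (λ k → trans (*-comm (fall q k) _) (cong (_* fall q k) (sym (S-partitions G k))))))

-- Comparison with K₂ and K₃

⊔-attained : ∀ {A : Set} (f : A → ℕ) xs {m} → foldr _⊔_ 0 (List.map f xs) ≡ suc m → ∃ λ x → f x ≡ suc m
⊔-attained f (x ∷ xs) e with ⊔-sel (f x) (foldr _⊔_ 0 (List.map f xs))
... | inj₁ e′ = x , trans (sym e′) e
... | inj₂ e′ = ⊔-attained f xs (trans (sym e′) e)

≤-⊔ : ∀ {A : Set} (f : A → ℕ) {x xs} → x ∈ xs → f x ≤ foldr _⊔_ 0 (List.map f xs)
≤-⊔ f (here refl) = m≤m⊔n _ _
≤-⊔ f (there p)   = ≤-trans (≤-⊔ f p) (m≤n⊔m _ _)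

neighbours : ∀ {n} → Graph n → Fin n → List (Fin n)
neighbours {n} G v = filter (λ w → adj G v w Bool.≟ true) (allFin n)

∈-neighbours : ∀ {n} (G : Graph n) {v w} → G ⊢ v ~ w → w ∈ neighbours G v
∈-neighbours G {v} {w} = ∈-filter⁺ (λ w → adj G v w Bool.≟ true) (∈-allFin w)

neighbours-∈ : ∀ {n} (G : Graph n) {v w} → w ∈ neighbours G v → G ⊢ v ~ w
neighbours-∈ {n} G {v} p = proj₂ (∈-filter⁻ (λ w → adj G v w Bool.≟ true) {xs = allFin n} p)

pigeonhole : ∀ {A : Set} (l : List A) {x y z} → length l ≤ 2 → x ∈ l → y ∈ l → z ∈ l → x ≡ y ⊎ y ≡ z ⊎ x ≡ z
pigeonhole (p ∷ [])     _ (here refl) (here refl) _ = inj₁ refl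
pigeonhole (p ∷ q ∷ []) _ (here refl) (here refl) _ = inj₁ refl
pigeonhole (p ∷ q ∷ []) _ (there (here refl)) (there (here refl)) _ = inj₁ refl
pigeonhole (p ∷ q ∷ []) _ (here refl) (there (here refl)) (here refl) = inj₂ (inj₂ refl)
pigeonhole (p ∷ q ∷ []) _ (here refl) (there (here refl)) (there (here refl)) = inj₂ (inj₁ refl)
pigeonhole (p ∷ q ∷ []) _ (there (here refl)) (here refl) (here refl) = inj₂ (inj₁ refl)
pigeonhole (p ∷ q ∷ []) _ (there (here refl)) (here refl) (there (here refl)) = inj₂ (inj₂ refl)
pigeonhole (p ∷ q ∷ r ∷ l) (s≤s (s≤s ())) _ _ _

maxDegree⇒atMostTwo : ∀ {n} (G : Graph n) → maxDegree G ≡ 2 → AtMostTwoNeighbours G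
maxDegree⇒atMostTwo {n} G Δ v vx vy vz = pigeonhole (neighbours G v)
  (≤-trans (≤-⊔ (deg G) (∈-allFin v)) (≤-reflexive Δ)) (∈-neighbours G vx) (∈-neighbours G vy) (∈-neighbours G vz)

maxDegree⇒cherry : ∀ {n} (G : Graph n) → maxDegree G ≡ 2 → HasCherry G
maxDegree⇒cherry {n} G Δ with ⊔-attained (deg G) (allFin n) Δ
... | v , e = go (neighbours G v) e (filter⁺ (λ w → adj G v w Bool.≟ true) (allFin⁺ n)) (neighbours-∈ G)
  where
  go : ∀ l → length l ≡ 2 → Unique l → (∀ {w} → w ∈ l → G ⊢ v ~ w) → HasCherry G
  go (x ∷ y ∷ []) refl ((x≢y ∷ _) ∷ _) nb = v , x , y , x≢y , nb (here refl) , nb (there (here refl))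

-- Chromatic polynomials of K_r ∪ pK₁ for r ≤ 3

chromatic-pK₁ : ∀ p q → chromatic (KrUnionPK1 0 p) q ≡ q ^ p
chromatic-pK₁ zero    q = refl
chromatic-pK₁ (suc p) q = trans (chromatic-isolated (KrUnionPK1 0 (suc p)) zero (λ w ()) q)
  (cong (q *_) (trans (chromatic-cong (KrUnionPK1 0 (suc p) -ᵥ zero) (KrUnionPK1 0 p) (λ i j → refl) q) (chromatic-pK₁ p q)))

-- Deleting vertex `zero` lowers every `toℕ` by one, so the remaining adjacency computes to that of
-- the graph with one clique vertex less; hence `λ i j → refl`, here and for K₂ and K₃.
chromatic-K₁ : ∀ p q → chromatic (KrUnionPK1 1 p) q ≡ q * q ^ p
chromatic-K₁ p q = trans (chromatic-isolated (KrUnionPK1 1 p) zero isolated q)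
  (cong (q *_) (trans (chromatic-cong (KrUnionPK1 1 p -ᵥ zero) (KrUnionPK1 0 p) (λ i j → refl) q) (chromatic-pK₁ p q)))
  where
  isolated : Isolated (KrUnionPK1 1 p) zero
  isolated zero ()
  isolated (suc w) ()

chromatic-K₂ : ∀ p q → chromatic (KrUnionPK1 2 p) q ≡ edgePoly (suc p) q
chromatic-K₂ p q = trans (chromatic-leaf (KrUnionPK1 2 p) zero zero refl only q)
  (cong ((q ∸ 1) *_) (trans (chromatic-cong (KrUnionPK1 2 p -ᵥ zero) (KrUnionPK1 1 p) (λ i j → refl) q) (chromatic-K₁ p q)))
  where
  only : ∀ w → KrUnionPK1 2 p ⊢ zero ~ suc w → w ≡ zero
  only zero    _  = refl
  only (suc w) ()

chromatic-K₃ : ∀ p q → chromatic (KrUnionPK1 3 p) q ≡ trianglePoly p q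
chromatic-K₃ p q = trans (chromatic-simplicial (KrUnionPK1 3 p) zero zero (suc zero) refl refl only refl q)
  (trans (cong₂ _*_ (sym (∸-+-assoc q 1 1)) (trans (chromatic-cong (KrUnionPK1 3 p -ᵥ zero) (KrUnionPK1 2 p) (λ i j → refl) q) (chromatic-K₂ p q)))
         (lemma (q ∸ 1 ∸ 1) (q ∸ 1) q (q ^ p)))
  where
  only : ∀ w → KrUnionPK1 3 p ⊢ zero ~ suc w → w ≡ zero ⊎ w ≡ suc zero
  only zero          _ = inj₁ refl
  only (suc zero)    _ = inj₂ refl
  only (suc (suc w)) ()
  lemma : ∀ a b c d → a * (b * (c * d)) ≡ c * (b * (a * 1)) * d
  lemma = solve-∀

transpose-left : ∀ {n} (i j : Fin n) → transpose i j ⟨$⟩ʳ i ≡ j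
transpose-left i j rewrite dec-true (i ≟ i) refl = refl

transpose-other : ∀ {n} {i j k : Fin n} → k ≢ i → k ≢ j → transpose i j ⟨$⟩ʳ k ≡ k
transpose-other {i = i} {j} {k} k≢i k≢j rewrite dec-false (k ≟ i) k≢i | dec-false (k ≟ j) k≢j = refl

permutation-injective : ∀ {n m} (π : Permutation n m) {i j} → π ⟨$⟩ʳ i ≡ π ⟨$⟩ʳ j → i ≡ j
permutation-injective π e = trans (sym (inverseˡ π)) (trans (cong (π ⟨$⟩ˡ_) e) (inverseˡ π))

-- Three transpositions bring `a`, `b`, `c` to positions 0, 1, 2 in turn; distinctness keeps each of
-- them away from the vertices already placed.
onlyTriangle⇒≅ : ∀ {m} (G : Graph (3 + m)) → OnlyTriangle G → G ≅ KrUnionPK1 3 m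
onlyTriangle⇒≅ {m} G T = π , preserves
  where
  open OnlyTriangle T
  H = KrUnionPK1 3 m
  0′ 1′ 2′ : Fin (3 + m)
  0′ = zero
  1′ = suc zero
  2′ = suc (suc zero)
  π₁ π₂ π : Permutation (3 + m) (3 + m)
  π₁ = transpose a 0′
  π₂ = π₁ ∘ₚ transpose (π₁ ⟨$⟩ʳ b) 1′
  π  = π₂ ∘ₚ transpose (π₂ ⟨$⟩ʳ c) 2′
  π₁a : π₁ ⟨$⟩ʳ a ≡ 0′
  π₁a = transpose-left a 0′
  π₂a : π₂ ⟨$⟩ʳ a ≡ 0′
  π₂a = trans (cong (transpose (π₁ ⟨$⟩ʳ b) 1′ ⟨$⟩ʳ_) π₁a)
    (transpose-other (λ e → a≢b (permutation-injective π₁ (trans π₁a e))) λ ())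
  π₂b : π₂ ⟨$⟩ʳ b ≡ 1′
  π₂b = transpose-left (π₁ ⟨$⟩ʳ b) 1′
  πa : π ⟨$⟩ʳ a ≡ 0′
  πa = trans (cong (transpose (π₂ ⟨$⟩ʳ c) 2′ ⟨$⟩ʳ_) π₂a)
    (transpose-other (λ e → a≢c (permutation-injective π₂ (trans π₂a e))) λ ())
  πb : π ⟨$⟩ʳ b ≡ 1′
  πb = trans (cong (transpose (π₂ ⟨$⟩ʳ c) 2′ ⟨$⟩ʳ_) π₂b)
    (transpose-other (λ e → b≢c (permutation-injective π₂ (trans π₂b e))) λ ())
  πc : π ⟨$⟩ʳ c ≡ 2′
  πc = transpose-left (π₂ ⟨$⟩ʳ c) 2′

  data Position (i : Fin (3 + m)) : Set where
    at-a : i ≡ a → Position i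
    at-b : i ≡ b → Position i
    at-c : i ≡ c → Position i
    off  : ∀ k → π ⟨$⟩ʳ i ≡ suc (suc (suc k)) → Position i

  position : ∀ i → Position i
  position i with π ⟨$⟩ʳ i in e
  ... | zero              = at-a (permutation-injective π (trans e (sym πa)))
  ... | suc zero          = at-b (permutation-injective π (trans e (sym πb)))
  ... | suc (suc zero)    = at-c (permutation-injective π (trans e (sym πc)))
  ... | suc (suc (suc k)) = off k e

  off-isolated : ∀ {i k} → π ⟨$⟩ʳ i ≡ suc (suc (suc k)) → ∀ j → adj G i j ≡ false
  off-isolated e j = ¬-not λ ij → clash e (all-edges ij)
    where
    clash : ∀ {i k} → π ⟨$⟩ʳ i ≡ suc (suc (suc k)) → ¬ (i ≡ a ⊎ i ≡ b ⊎ i ≡ c)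
    clash e (inj₁ refl) with trans (sym πa) e
    ... | ()
    clash e (inj₂ (inj₁ refl)) with trans (sym πb) e
    ... | ()
    clash e (inj₂ (inj₂ refl)) with trans (sym πc) e
    ... | ()

  preserves : ∀ i j → adj H (π ⟨$⟩ʳ i) (π ⟨$⟩ʳ j) ≡ adj G i j
  preserves i j with position i | position j
  ... | off k e   | _         = trans (cong (λ z → adj H z (π ⟨$⟩ʳ j)) e) (sym (off-isolated e j))
  ... | at-a refl | off k e   = trans (cong₂ (adj H) πa e) (sym (trans (Graph.sym G i j) (off-isolated e i)))
  ... | at-b refl | off k e   = trans (cong₂ (adj H) πb e) (sym (trans (Graph.sym G i j) (off-isolated e i)))
  ... | at-c refl | off k e   = trans (cong₂ (adj H) πc e) (sym (trans (Graph.sym G i j) (off-isolated e i)))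
  ... | at-a refl | at-a refl = trans (cong₂ (adj H) πa πa) (sym (irrefl G i))
  ... | at-b refl | at-b refl = trans (cong₂ (adj H) πb πb) (sym (irrefl G i))
  ... | at-c refl | at-c refl = trans (cong₂ (adj H) πc πc) (sym (irrefl G i))
  ... | at-a refl | at-b refl = trans (cong₂ (adj H) πa πb) (sym ab)
  ... | at-a refl | at-c refl = trans (cong₂ (adj H) πa πc) (sym ac)
  ... | at-b refl | at-a refl = trans (cong₂ (adj H) πb πa) (sym (adj-sym G ab))
  ... | at-b refl | at-c refl = trans (cong₂ (adj H) πb πc) (sym bc)
  ... | at-c refl | at-a refl = trans (cong₂ (adj H) πc πa) (sym (adj-sym G ac))
  ... | at-c refl | at-b refl = trans (cong₂ (adj H) πc πb) (sym (adj-sym G bc))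

-- From chromatic polynomials to rational averages

ratio-mono-≤ : ∀ {t b t′ b′} → 0 < b → 0 < b′ → t * b′ ≤ t′ * b → ratio t b ℚ.≤ ratio t′ b′
ratio-mono-≤ {t} {suc b} {t′} {suc b′} _ _ le = ℚ.toℚᵘ-cancel-≤
  (ℚᵘ.≤-respʳ-≃ (ℚᵘ.≃-sym (ℚ.toℚᵘ-fromℚᵘ (mkℚᵘ (ℤ.+ t′) b′)))
  (ℚᵘ.≤-respˡ-≃ (ℚᵘ.≃-sym (ℚ.toℚᵘ-fromℚᵘ (mkℚᵘ (ℤ.+ t) b)))
  (*≤* (subst₂ ℤ._≤_ (ℤ.pos-* t (suc b′)) (ℤ.pos-* t′ (suc b)) (ℤ.+≤+ le)))))

ratio-mono-< : ∀ {t b t′ b′} → 0 < b → 0 < b′ → t * b′ < t′ * b → ratio t b ℚ.< ratio t′ b′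
ratio-mono-< {t} {suc b} {t′} {suc b′} _ _ lt = ℚ.toℚᵘ-cancel-<
  (ℚᵘ.<-respʳ-≃ (ℚᵘ.≃-sym (ℚ.toℚᵘ-fromℚᵘ (mkℚᵘ (ℤ.+ t′) b′)))
  (ℚᵘ.<-respˡ-≃ (ℚᵘ.≃-sym (ℚ.toℚᵘ-fromℚᵘ (mkℚᵘ (ℤ.+ t) b)))
  (*<* (subst₂ ℤ._<_ (ℤ.pos-* t (suc b′)) (ℤ.pos-* t′ (suc b)) (ℤ.+<+ lt)))))

sumTo≡0⇒fallSum≡0 : ∀ n s q → sumTo n s ≡ 0 → fallSum n s q ≡ 0
sumTo≡0⇒fallSum≡0 zero    s q e = refl
sumTo≡0⇒fallSum≡0 (suc n) s q e = cong₂ _+_ (sumTo≡0⇒fallSum≡0 n s q (m+n≡0⇒m≡0 _ e))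
  (cong (_* fall q (suc n)) (m+n≡0⇒n≡0 (sumTo n s) e))

-- Keeps the default value of `ratio` at denominator 0 out of play: if all `S G k` were 0, the
-- chromatic polynomial would vanish at 3.
𝓑>0 : ∀ {n} (G : Graph (suc n)) → 0 < chromatic G 3 → 0 < 𝓑 G
𝓑>0 {n} G p with 𝓑 G in e
... | suc _ = s≤s z≤n
... | zero  = ⊥-elim (>0⇒≢0 p (trans (chromatic-fallSum G 3) (sumTo≡0⇒fallSum≡0 (suc n) (S G) 3 e)))

module Compare {n m} (G : Graph (suc n)) (H : Graph (suc m)) (g : 0 < chromatic G 3) (h : 0 < chromatic H 3) where

  𝓐-≤ : chromatic G ⊒ chromatic H → 𝓐 H ℚ.≤ 𝓐 G
  𝓐-≤ w = ratio-mono-≤ (𝓑>0 H h) (𝓑>0 G g) (≤-trans (≤-reflexive (*-comm (𝓣 H) (𝓑 G)))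
    (averages-≤ (suc n) (S G) (suc m) (S H) (⊒-cong (chromatic-fallSum G) (chromatic-fallSum H) w)))

  𝓐-< : chromatic G ⊒ chromatic H → chromatic G ⊐ chromatic H → 𝓐 H ℚ.< 𝓐 G
  𝓐-< w s = ratio-mono-< (𝓑>0 H h) (𝓑>0 G g) (≤-trans (≤-reflexive (cong suc (*-comm (𝓣 H) (𝓑 G))))
    (averages-< (suc n) (S G) (suc m) (S H) (⊒-cong (chromatic-fallSum G) (chromatic-fallSum H) w)
      (⊐-cong (chromatic-fallSum G) (chromatic-fallSum H) s)))

  -- Both sides of the equivalence are false: the averages differ, and isomorphic graphs would have
  -- equal chromatic polynomials, contradicting the increase between 3 and 4.
  strict : chromatic G ⊒ chromatic H → chromatic G ⊐ chromatic H → 𝓐 H ℚ.≤ 𝓐 G × (𝓐 G ≡ 𝓐 H ⇔ G ≅ H)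
  strict w s = ℚ.<⇒≤ (𝓐-< w s) , mk⇔ (λ e → ⊥-elim (ℚ.<-irrefl (sym e) (𝓐-< w s)))
    (λ iso → ⊥-elim (<-irrefl (trans (cong (_* chromatic H 4) (chromatic-≅ G H iso 3))
      (trans (*-comm (chromatic H 3) (chromatic H 4)) (cong (_* chromatic H 3) (sym (chromatic-≅ G H iso 4))))) (ratio-< s)))

-- Isomorphism is only known to preserve chromatic polynomials, so equality of the averages is
-- obtained from the weak comparison in both directions.
≅⇒equal : ∀ {n m} (G : Graph (suc n)) (H : Graph (suc m)) → 0 < chromatic G 3 → G ≅ H →
          𝓐 H ℚ.≤ 𝓐 G × (𝓐 G ≡ 𝓐 H ⇔ G ≅ H)
≅⇒equal G H g iso = ℚ.≤-reflexive (sym 𝓐G≡𝓐H) , mk⇔ (λ _ → iso) (λ _ → 𝓐G≡𝓐H)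
  where
  e = chromatic-≅ G H iso
  h : 0 < chromatic H 3
  h = subst (0 <_) (e 3) g
  𝓐G≡𝓐H : 𝓐 G ≡ 𝓐 H
  𝓐G≡𝓐H = ℚ.≤-antisym (Compare.𝓐-≤ H G h g (⊒-cong e (λ _ → refl) ⊒-refl)) (Compare.𝓐-≤ G H g h (⊒-cong (λ _ → refl) e ⊒-refl))

theorem26 : (n : ℕ) (G : Graph n) (χ : ℕ) → maxDegree G ≡ 2 → IsChromaticNumber G χ →
    (𝓐 (KrUnionPK1 χ (n ∸ χ)) ℚ.≤ 𝓐 G) ×
    ((𝓐 G ≡ 𝓐 (KrUnionPK1 χ (n ∸ χ))) ⇔ (G ≅ KrUnionPK1 χ (n ∸ χ)))
theorem26 n G χ Δ (colouring , minimal) = go χ n G colouring minimal (maxDegree⇒cherry G Δ) (bounds G (maxDegree⇒atMostTwo G Δ))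
  where
  go : ∀ χ n (G : Graph n) → Σ (Fin n → Fin χ) (Proper G) → (∀ m → m < χ → ¬ Σ (Fin n → Fin m) (Proper G)) →
       HasCherry G → Bounds G → 𝓐 (KrUnionPK1 χ (n ∸ χ)) ℚ.≤ 𝓐 G × (𝓐 G ≡ 𝓐 (KrUnionPK1 χ (n ∸ χ)) ⇔ G ≅ KrUnionPK1 χ (n ∸ χ))
  go zero n G (f , _) _ (v , _) B with f v
  ... | ()
  go (suc zero) n G (f , proper) _ (v , x , _ , _ , vx , _) B with f v in e | f x in e′
  ... | zero | zero = ⊥-elim (proper v x vx (trans e (sym e′)))
  -- A single vertex cannot carry a cherry; afterwards `n` has the form `2 + p` and `n ∸ 2` reduces
  -- to `p`.
  go (suc (suc zero)) (suc zero) G _ _ (_ , zero , zero , x≢y , _) B = ⊥-elim (x≢y refl)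
  go (suc (suc zero)) (suc (suc p)) G c _ cherry B = Compare.strict G (KrUnionPK1 2 p) (Bounds.positive₃ B)
    (subst (0 <_) (eq 3) (*-mono-≤ {1} {2} (s≤s z≤n) (m^n>0 3 (suc p))))
    (⊒-cong (λ _ → refl) eq (Bounds.⊒edge B cherry (colouring⇒chromatic>0 G c)))
    (⊐-cong (λ _ → refl) eq (Bounds.⊐edge B cherry (colouring⇒chromatic>0 G c)))
    where
    eq : edgePoly (suc p) ≗ chromatic (KrUnionPK1 2 p)
    eq q = sym (chromatic-K₂ p q)
  -- Minimality excludes a 2-colouring, so `chromatic G 2` is 0 and `triangle` applies; its equation
  -- for `n` makes `n ∸ 3` reduce to `m`.
  go (suc (suc (suc zero))) n G _ minimal _ B with Bounds.triangle B (n≤0⇒n≡0 (≮⇒≥ λ p → minimal 2 ≤-refl (chromatic>0⇒colouring G p)))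
  ... | m , refl , weak , inj₂ T = ≅⇒equal G (KrUnionPK1 3 m) (Bounds.positive₃ B) (onlyTriangle⇒≅ G T)
  ... | m , refl , weak , inj₁ s = Compare.strict G (KrUnionPK1 3 m) (Bounds.positive₃ B)
    (subst (0 <_) (eq 3) (trianglePoly>0 m)) (⊒-cong (λ _ → refl) eq weak) (⊐-cong (λ _ → refl) eq s)
    where
    eq : trianglePoly m ≗ chromatic (KrUnionPK1 3 m)
    eq q = sym (chromatic-K₃ m q)
  -- Positivity at 3 is a 3-colouring, against minimality.
  go (suc (suc (suc (suc χ)))) n G _ minimal _ B =
    ⊥-elim (minimal 3 (s≤s (s≤s (s≤s (s≤s z≤n)))) (chromatic>0⇒colouring G (Bounds.positive₃ B)))
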